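{- Let $q=p^k$ be an odd prime power with $q\equiv 2\pmod 3$. Let $X$ be a cubic arc-transitive graph of type $\{1,2^1\}$ whose full automorphism group is $G^*=\mathrm{PGL}(2,q)$, such that $G=\mathrm{PSL}(2,q)\le G^*$ is a $1$-arc-regular subgroup of automorphisms. Then the intersection density of $G$ acting on the vertex set of $X$ is \[ \rho(G)=\begin{cases} \tfrac43 & \text{if } q=5^{2k+1} \text{ for some integer } k\ge 0,\\ 1 & \text{if } q\equiv \pm 2 \pmod 5,\\ \tfrac43 & \text{if } q\equiv \pm 1 \pmod 5. \end{cases} \]
   Context: For a transitive permutation group $H\le \mathrm{Sym}(V)$, a subset $\mathcal F\subseteq H$ is intersecting if any two $f,g\in\mathcal F$ satisfy $f(v)=g(v)$ for some $v\in V$; the intersection density is $\rho(H)=\max\{|\mathcal F|:\mathcal F\subseteq H\text{ intersecting}\}/(|H|/|V|)$. An $s$-arc is a sequence $(u_0,\dots,u_s)$ of distinct vertices with consecutive ones adjacent; a group is $s$-arc-regular if it acts regularly on $s$-arcs. A cubic arc-transitive graph $X$ is of type $\{1,2^1\}$ if its full automorphism group acts regularly on $2$-arcs, it has a subgroup acting regularly on arcs, and the edge stabilizer in $\mathrm{Aut}(X)$ is isomorphic to $\mathbb{Z}_2^2$. -}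

module Defs where

open import Level using (0ℓ)
open import Data.Nat using (ℕ; zero; suc; _+_; _*_; _^_; _≥_; _≤_; _%_)
open import Data.Fin using (Fin)
open import Data.Bool using (Bool; true; false; _xor_)
open import Data.Product using (Σ; ∃; ∃-syntax; _×_; _,_)
open import Data.Sum using (_⊎_)
open import Data.List using (List; length)
open import Data.List.Membership.Propositional using (_∈_)
open import Data.List.Relation.Unary.All using (All)
open import Data.List.Relation.Unary.Any using (Any)
open import Data.List.Relation.Unary.AllPairs using (AllPairs)
open import Data.Nat.Primality using (Prime)
open import Function using (_∘_; id)
open import Function.Definitions using (Injective)
open import Relation.Nullary using (¬_; Dec)
open import Relation.Binary.PropositionalEquality using (_≡_; _≢_)
open import Algebra.Structures using (IsCommutativeRing)

record FieldOn (q : ℕ) : Set where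
  field
    _+F_ : Fin q → Fin q → Fin q
    _*F_ : Fin q → Fin q → Fin q
    -F_  : Fin q → Fin q
    0F   : Fin q
    1F   : Fin q
    isCommutativeRing : IsCommutativeRing _≡_ _+F_ _*F_ -F_ 0F 1F
    0≢1  : 0F ≢ 1F
    inverse : ∀ x → x ≢ 0F → ∃[ y ] (x *F y ≡ 1F)
  infixl 6 _+F_
  infixl 7 _*F_
  infix 8 -F_

module Matrices {q : ℕ} (F : FieldOn q) where
  open FieldOn F

  record Mat : Set where
    constructor mat
    field
      a b c d : Fin q

  open Mat public

  _·_ : Mat → Mat → Mat
  A · B = mat (a A *F a B +F b A *F c B) (a A *F b B +F b A *F d B)
              (c A *F a B +F d A *F c B) (c A *F b B +F d A *F d B)

  det : Mat → Fin q
  det A = a A *F d A +F (-F (b A *F c A))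

  InGL : Mat → Set
  InGL A = det A ≢ 0F

  InSL : Mat → Set
  InSL A = det A ≡ 1F

  Scalar : Mat → Set
  Scalar A = b A ≡ 0F × c A ≡ 0F × a A ≡ d A

record Graph (n : ℕ) : Set₁ where
  field
    Adj : Fin n → Fin n → Set
    adj? : ∀ u v → Dec (Adj u v)
    sym : ∀ {u v} → Adj u v → Adj v u
    irrefl : ∀ {u} → ¬ Adj u u

module _ {n : ℕ} (X : Graph n) where
  open Graph X

  data Reachable : Fin n → Fin n → Set where
    here : ∀ {u} → Reachable u u
    step : ∀ {u v w} → Adj u v → Reachable v w → Reachable u w

  Connected : Set
  Connected = ∀ u v → Reachable u v

  Cubic : Set
  Cubic = ∀ u → ∃[ x ] ∃[ y ] ∃[ z ]
    (Adj u x × Adj u y × Adj u z × x ≢ y × x ≢ z × y ≢ z ×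
     (∀ w → Adj u w → w ≡ x ⊎ w ≡ y ⊎ w ≡ z))

Perm : ℕ → Set
Perm n = Fin n → Fin n

_≈ₚ_ : ∀ {n} → Perm n → Perm n → Set
σ ≈ₚ τ = ∀ x → σ x ≡ τ x

PermSet : ℕ → Set₁
PermSet n = Perm n → Set

module _ {n : ℕ} (X : Graph n) where
  open Graph X

  IsAut : Perm n → Set
  IsAut σ = Injective _≡_ _≡_ σ × (∀ u v → (Adj u v → Adj (σ u) (σ v)) × (Adj (σ u) (σ v) → Adj u v))

  ArcRegular : PermSet n → Set
  ArcRegular H =
    (∀ u v u' v' → Adj u v → Adj u' v' → ∃[ g ] (H g × g u ≡ u' × g v ≡ v')) ×
    (∀ u v g h → Adj u v → H g → H h → g u ≡ h u → g v ≡ h v → g ≈ₚ h)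

  TwoArcRegular : PermSet n → Set
  TwoArcRegular H =
    (∀ u₀ u₁ u₂ w₀ w₁ w₂ → Adj u₀ u₁ → Adj u₁ u₂ → u₀ ≢ u₂ →
       Adj w₀ w₁ → Adj w₁ w₂ → w₀ ≢ w₂ →
       ∃[ g ] (H g × g u₀ ≡ w₀ × g u₁ ≡ w₁ × g u₂ ≡ w₂)) ×
    (∀ u₀ u₁ u₂ g h → Adj u₀ u₁ → Adj u₁ u₂ → u₀ ≢ u₂ → H g → H h →
       g u₀ ≡ h u₀ → g u₁ ≡ h u₁ → g u₂ ≡ h u₂ → g ≈ₚ h)

  SubgroupOfAut : PermSet n → Set
  SubgroupOfAut H =
    (∀ g → H g → IsAut g) × H id × (∀ g h → H g → H h → H (g ∘ h)) ×
    (∀ g → H g → ∃[ g' ] (H g' × (g' ∘ g) ≈ₚ id)) ×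
    (∀ g h → g ≈ₚ h → H g → H h)

  EdgeStab : Fin n → Fin n → PermSet n
  EdgeStab u v g = IsAut g × ((g u ≡ u × g v ≡ v) ⊎ (g u ≡ v × g v ≡ u))

IsoZ2xZ2 : ∀ {n} → PermSet n → Set
IsoZ2xZ2 {n} S = Σ (Bool → Bool → Perm n) λ ψ →
  ((∀ x y x' y' → ψ (x xor x') (y xor y') ≈ₚ (ψ x y ∘ ψ x' y')) ×
   (∀ x y x' y' → ψ x y ≈ₚ ψ x' y' → (x ≡ x' × y ≡ y')) ×
   (∀ x y → S (ψ x y)) ×
   (∀ g → S g → ∃[ x ] ∃[ y ] (g ≈ₚ ψ x y)))

module _ {n : ℕ} (X : Graph n) where
  open Graph X

  TypeOne2one : Set₁
  TypeOne2one =
    TwoArcRegular X (IsAut X) ×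
    (∃[ H ] (SubgroupOfAut X H × ArcRegular X H)) ×
    (∀ u v → Adj u v → IsoZ2xZ2 (EdgeStab X u v))

Distinct : ∀ {n} → List (Perm n) → Set
Distinct = AllPairs (λ f g → ¬ (f ≈ₚ g))

HasOrder : ∀ {n} → PermSet n → ℕ → Set
HasOrder H m = ∃[ L ] (length L ≡ m × All H L × Distinct L ×
                       (∀ g → H g → Any (g ≈ₚ_) L))

Intersecting : ∀ {n} → PermSet n → List (Perm n) → Set
Intersecting {n} H L = All H L × Distinct L ×
  (∀ f g → f ∈ L → g ∈ L → ∃[ v ] (f v ≡ g v))

MaxIntersectingSize : ∀ {n} → PermSet n → ℕ → Set
MaxIntersectingSize H s =
  (∃[ L ] (Intersecting H L × length L ≡ s)) ×
  (∀ L → Intersecting H L → length L ≤ s)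

-- ρ(H) = num / den, where ρ(H) = (max intersecting size) / (|H| / n)
DensityIs : ∀ {n} → PermSet n → ℕ → ℕ → Set
DensityIs {n} H num den = ∃[ s ] ∃[ m ]
  (HasOrder H m × MaxIntersectingSize H s × s * n * den ≡ num * m)

IsPrimePower : ℕ → Set
IsPrimePower q = ∃[ p ] ∃[ k ] (Prime p × k ≥ 1 × q ≡ p ^ k)

{-# OPTIONS --safe #-}
module Submission where

-- A vertex stabiliser in G has order 3, so |G| = 3 n, and since q ≡ 2 (mod 3) all elements
-- of order 3 in PSL(2,q), that is, the matrices of trace ±1, are conjugate under PGL(2,q).
-- Hence a nontrivial element of G fixes a vertex exactly when its trace is ±1, and an
-- intersecting set is a set of matrices in SL(2,q) any two of which satisfy ⟨A , B⟩ = ±1,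
-- where ⟨_,_⟩ is the polar form of det.  This form has square discriminant on the
-- 4-dimensional space of matrices, so the Gram determinant of four matrices is a square.
-- Up to signs it is 5, -3 or -27, and -3 is not a square as q ≡ 2 (mod 3).  So four members
-- have, after a choice of signs, all their pairings equal to 1 and force 5 to be a square;
-- five members would be linearly independent.  Conversely, 1 and (1 + i + j ± k) / 2 in a
-- quaternion basis always form an intersecting set, and a square root of 5 gives a fourth
-- member, an icosian.  Whether 5 is a square is decided by counting the orbits of the
-- pentagon recurrence and of an element of order 5.

open import Defs
open import Level using (0ℓ)
open import Algebra.Bundles using (CommutativeRing)
open import Algebra.Solver.Ring.AlmostCommutativeRing using (fromCommutativeRing; _-Raw-AlmostCommutative⟶_)
import Algebra.Solver.Ring
import Algebra.Properties.Ring
import Algebra.Properties.AbelianGroup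
import Algebra.Properties.Semiring.Mult.TCOptimised
open import Data.Nat as ℕ using (ℕ; zero; suc; pred; _+_; _*_; _^_; _∸_; _%_; _≤_; _<_; z≤n; s≤s; s≤s⁻¹; NonZero; >-nonZero; >-nonZero⁻¹)
import Data.Nat.Properties as ℕₚ
open import Data.Nat.DivMod using ([m+kn]%n≡m%n; %-distribˡ-*)
open import Data.Nat.Divisibility using (_∣_; divides; n∣m⇒m%n≡0; m∣m*n; ∣m∣n⇒∣m+n; ∣-refl; _∣0)
open import Data.Nat.Primality using (Prime; prime?; prime⇒nonZero; euclidsLemma)
open import Data.Nat.Coprimality using (prime⇒coprime; coprime-Bézout)
open import Data.Nat.GCD using (module Bézout)
open import Data.Nat.GeneralisedArithmetic using (fold; fold-+)
open import Data.Integer.Base as ℤ using (ℤ; +_; -[1+_])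
import Data.Integer.Properties as ℤₚ
open import Data.Fin as Fin using (Fin; zero; suc; toℕ)
open import Data.Fin.Properties as Finₚ using (_≟_; pigeonhole; toℕ-injective)
open import Data.List.Base using (List; []; _∷_; length; map; filter; foldr; applyUpTo; allFin; cartesianProduct)
open import Data.List.Properties using (length-++; length-map; length-tabulate; length-applyUpTo; filter-accept; filter-reject; filter-all)
open import Data.List.Membership.Propositional using (_∈_; _∉_)
open import Data.List.Membership.Propositional.Properties
open import Data.List.Relation.Unary.Any as Any using (here; there)
import Data.List.Relation.Unary.Any.Properties as Any
open import Data.List.Relation.Unary.All as All using (All; []; _∷_)
import Data.List.Relation.Unary.All.Properties as All
open import Data.List.Relation.Unary.AllPairs as AllPairs using (AllPairs; []; _∷_)
import Data.List.Relation.Unary.AllPairs.Properties as AllPairs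
open import Data.List.Relation.Unary.Unique.Propositional using (Unique)
import Data.List.Relation.Unary.Unique.Propositional.Properties as Unique
open import Data.Maybe.Base as Maybe using (Maybe)
open import Data.Product using (_×_; _,_; proj₁; proj₂; ∃-syntax)
open import Data.Product.Properties using (≡-dec)
open import Data.Sum using (_⊎_; inj₁; inj₂; [_,_]′)
open import Data.Empty using (⊥; ⊥-elim)
open import Function using (id; _∘_; case_of_)
open import Function.Definitions using (Injective)
open import Relation.Nullary using (¬_; Dec; yes; no; ¬?)
open import Relation.Nullary.Decidable using (from-yes; dec⇒maybe)
open import Relation.Binary.Definitions using (DecidableEquality)
open import Relation.Binary.PropositionalEquality

-- Free actions of cyclic groups of prime order

length-cartesianProduct : ∀ {A B : Set} (xs : List A) (ys : List B) →
  length (cartesianProduct xs ys) ≡ length xs * length ys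
length-cartesianProduct []       ys = refl
length-cartesianProduct (x ∷ xs) ys = trans (length-++ (map (x ,_) ys))
  (cong₂ _+_ (length-map (x ,_) ys) (length-cartesianProduct xs ys))

module Removal {A : Set} (_≟_ : DecidableEquality A) where

  _-_ : List A → A → List A
  xs - a = filter (λ x → ¬? (x ≟ a)) xs

  _∖_ : List A → List A → List A
  xs ∖ as = foldr (λ a ys → ys - a) xs as

  length-removal : ∀ {xs a} → Unique xs → a ∈ xs → length xs ≡ suc (length (xs - a))
  length-removal {a = a} (x∉xs ∷ _) (here refl) = cong (suc ∘ length)
    (sym (trans (filter-reject (λ x → ¬? (x ≟ a)) (λ a≢a → a≢a refl))
                (filter-all (λ x → ¬? (x ≟ a)) (All.map (λ a≢x x≡a → a≢x (sym x≡a)) x∉xs))))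
  length-removal {a = a} (x∉xs ∷ uniq) (there a∈xs) = cong suc
    (trans (length-removal uniq a∈xs)
           (cong length (sym (filter-accept (λ x → ¬? (x ≟ a)) (All.lookup x∉xs a∈xs)))))

  ∖-unique : ∀ {xs} as → Unique xs → Unique (xs ∖ as)
  ∖-unique []       uniq = uniq
  ∖-unique (a ∷ as) uniq = Unique.filter⁺ (λ x → ¬? (x ≟ a)) (∖-unique as uniq)

  ∈-∖⁺ : ∀ {xs x} as → x ∈ xs → x ∉ as → x ∈ xs ∖ as
  ∈-∖⁺ []       x∈xs x∉as = x∈xs
  ∈-∖⁺ (a ∷ as) x∈xs x∉as =
    ∈-filter⁺ (λ x → ¬? (x ≟ a)) (∈-∖⁺ as x∈xs (x∉as ∘ there)) (x∉as ∘ here)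

  ∈-∖⁻ : ∀ {xs x} as → x ∈ xs ∖ as → x ∈ xs × x ∉ as
  ∈-∖⁻ []       x∈xs = x∈xs , λ ()
  ∈-∖⁻ {xs} {x} (a ∷ as) x∈ with ∈-filter⁻ (λ x → ¬? (x ≟ a)) {xs = xs ∖ as} x∈
  ... | x∈xs∖as , x≢a with ∈-∖⁻ as x∈xs∖as
  ... | x∈xs , x∉as = x∈xs , λ { (here x≡a) → x≢a x≡a ; (there x∈as) → x∉as x∈as }

  length-∖ : ∀ {xs as} → Unique xs → Unique as → (∀ {x} → x ∈ as → x ∈ xs) →
             length xs ≡ length as + length (xs ∖ as)
  length-∖ {as = []} _ _ _ = refl
  length-∖ {xs} {a ∷ as} uniq (a∉as ∷ uniq′) as⊆xs = begin
    length xs                              ≡⟨ length-∖ uniq uniq′ (as⊆xs ∘ there) ⟩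
    length as + length (xs ∖ as)           ≡⟨ cong (λ k → length as + k) (length-removal (∖-unique as uniq)
                                                (∈-∖⁺ as (as⊆xs (here refl)) λ a∈as → All.lookup a∉as a∈as refl)) ⟩
    length as + suc (length ((xs ∖ as) - a)) ≡⟨ ℕₚ.+-suc (length as) _ ⟩
    suc (length as + length ((xs ∖ as) - a)) ∎
    where open ≡-Reasoning

module CyclicAction {A : Set} (_≟_ : DecidableEquality A) {p : ℕ} (p-prime : Prime p) (f : A → A) where
  open Removal _≟_

  private instance
    p≢0 : NonZero p
    p≢0 = prime⇒nonZero p-prime

  fold-multiple : ∀ {x k} → fold x f k ≡ x → ∀ m → fold x f (m * k) ≡ x
  fold-multiple         fix zero    = refl
  fold-multiple {x} {k} fix (suc m) = trans (fold-+ x f k)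
    (trans (cong (λ y → fold y f k) (fold-multiple fix m)) fix)

  -- Bézout for the coprime numbers k and p gives a multiple of one that exceeds a multiple of the
  -- other by 1. Both multiples fix x, so the one extra step fixes x as well.
  fixed-by-power : ∀ {x k} .{{_ : NonZero k}} → k < p → fold x f p ≡ x → fold x f k ≡ x → f x ≡ x
  fixed-by-power {x} {k} k<p fixₚ fixₖ with coprime-Bézout (prime⇒coprime p-prime k<p)
  ... | Bézout.+- a b eq = begin
    f x                    ≡⟨ cong f (sym (fold-multiple fixₖ b)) ⟩
    fold x f (suc (b * k)) ≡⟨ cong (fold x f) eq ⟩
    fold x f (a * p)       ≡⟨ fold-multiple fixₚ a ⟩
    x                      ∎
    where open ≡-Reasoning
  ... | Bézout.-+ a b eq = begin
    f x                    ≡⟨ cong f (sym (fold-multiple fixₚ a)) ⟩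
    fold x f (suc (a * p)) ≡⟨ cong (fold x f) eq ⟩
    fold x f (b * k)       ≡⟨ fold-multiple fixₖ b ⟩
    x                      ∎
    where open ≡-Reasoning

  orbit : A → List A
  orbit x = applyUpTo (fold x f) p

  orbit-unique : ∀ {x} → fold x f p ≡ x → f x ≢ x → Unique (orbit x)
  orbit-unique {x} fixₚ free = Unique.applyUpTo⁺₁ (fold x f) p distinct
    where
    open ≡-Reasoning
    distinct : ∀ {i j} → i < j → j < p → fold x f i ≢ fold x f j
    distinct {i} {j} i<j j<p eq = free (fixed-by-power {{>-nonZero 0<k}} k<p fixₚ fixₖ)
      where
      -- No inverse of f is given with which to cancel i steps. Instead both sides advance by p - j
      -- steps: the later one completes the period and the earlier one becomes the k-th iterate,
      -- with 0 < k < p.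
      k = p ∸ j + i
      0<k : 0 < k
      0<k = ℕₚ.≤-trans (ℕₚ.m<n⇒0<n∸m j<p) (ℕₚ.m≤m+n (p ∸ j) i)
      k<p : k < p
      k<p = subst (k <_) (ℕₚ.m∸n+n≡m (ℕₚ.<⇒≤ j<p)) (ℕₚ.+-monoʳ-< (p ∸ j) i<j)
      fixₖ : fold x f k ≡ x
      fixₖ = begin
        fold x f k                    ≡⟨ fold-+ x f (p ∸ j) ⟩
        fold (fold x f i) f (p ∸ j)   ≡⟨ cong (λ y → fold y f (p ∸ j)) eq ⟩
        fold (fold x f j) f (p ∸ j)   ≡⟨ sym (fold-+ x f (p ∸ j)) ⟩
        fold x f (p ∸ j + j)          ≡⟨ cong (fold x f) (ℕₚ.m∸n+n≡m (ℕₚ.<⇒≤ j<p)) ⟩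
        fold x f p                    ≡⟨ fixₚ ⟩
        x                             ∎

  module _ (xs : List A) where

    Closed Periodic Free : Set
    Closed   = ∀ {x} → x ∈ xs → f x ∈ xs
    Periodic = ∀ {x} → x ∈ xs → fold x f p ≡ x
    Free     = ∀ {x} → x ∈ xs → f x ≢ x

  closed-fold : ∀ {xs x} → Closed xs → x ∈ xs → ∀ k → fold x f k ∈ xs
  closed-fold closed x∈xs zero    = x∈xs
  closed-fold closed x∈xs (suc k) = closed (closed-fold closed x∈xs k)

  -- Since y is the (p - 1)-st iterate of f y, it cannot lie outside an orbit that contains f y.
  -- Hence the complement of an orbit is again closed under f.
  orbit-closed⁻ : ∀ {x y} → fold x f p ≡ x → fold y f p ≡ y → f y ∈ orbit x → y ∈ orbit x
  orbit-closed⁻ {x} {y} fixˣ fixʸ fy∈ with ∈-applyUpTo⁻ (fold x f) fy∈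
  ... | i , i<p , eq = subst (_∈ orbit x) (sym y≡) (reduce i i<p)
    where
    open ≡-Reasoning
    r = pred p
    y≡ : y ≡ fold x f (r + i)
    y≡ = begin
      y                     ≡⟨ sym fixʸ ⟩
      fold y f p            ≡⟨ cong (fold y f) (sym (trans (ℕₚ.+-comm r 1) (ℕₚ.suc-pred p))) ⟩
      fold y f (r + 1)      ≡⟨ fold-+ y f r ⟩
      fold (f y) f r        ≡⟨ cong (λ z → fold z f r) eq ⟩
      fold (fold x f i) f r ≡⟨ sym (fold-+ x f r) ⟩
      fold x f (r + i)      ∎
    -- The exponent p - 1 + i is below p only for i = 0; otherwise it is p + (i - 1) and the period
    -- removes p.
    reduce : ∀ i → i < p → fold x f (r + i) ∈ orbit x
    reduce zero    _   = ∈-applyUpTo⁺ (fold x f) (subst₂ _<_ (sym (ℕₚ.+-identityʳ r)) (ℕₚ.suc-pred p) (ℕₚ.n<1+n r))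
    reduce (suc i) i<p = subst (_∈ orbit x) (begin
      fold x f i              ≡⟨ cong (λ z → fold z f i) (sym fixˣ) ⟩
      fold (fold x f p) f i   ≡⟨ sym (fold-+ x f i) ⟩
      fold x f (i + p)        ≡⟨ cong (fold x f) (ℕₚ.+-comm i p) ⟩
      fold x f (p + i)        ≡⟨ cong (λ k → fold x f (k + i)) (sym (ℕₚ.suc-pred p)) ⟩
      fold x f (suc (r + i))  ≡⟨ cong (fold x f) (sym (ℕₚ.+-suc r i)) ⟩
      fold x f (r + suc i)    ∎) (∈-applyUpTo⁺ (fold x f) (ℕₚ.<-trans (ℕₚ.n<1+n i) i<p))

  -- A free orbit has exactly p elements, and deleting it preserves all hypotheses. The recursion
  -- runs on a bound n for the length because what remains is not the tail of the list.
  free⇒p∣length : ∀ {xs} → Unique xs → Closed xs → Periodic xs → Free xs → p ∣ length xs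
  free⇒p∣length {xs} = go (length xs) xs ℕₚ.≤-refl
    where
    go : ∀ n xs → length xs ≤ n → Unique xs → Closed xs → Periodic xs → Free xs → p ∣ length xs
    go n       []        _     _    _      _      _    = p ∣0
    go (suc n) xs@(x ∷ _) len≤n uniq closed period free =
      subst (p ∣_) (sym split) (∣m∣n⇒∣m+n ∣-refl (go n rest rest≤n
        (∖-unique (orbit x) uniq)
        (λ y∈ → let (y∈xs , y∉) = ∈-∖⁻ (orbit x) y∈ in
          ∈-∖⁺ (orbit x) (closed y∈xs) (y∉ ∘ orbit-closed⁻ fixₚ (period y∈xs)))
        (period ∘ proj₁ ∘ ∈-∖⁻ (orbit x))
        (free ∘ proj₁ ∘ ∈-∖⁻ (orbit x))))
      where
      fixₚ = period (here refl)
      rest = xs ∖ orbit x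
      split : length xs ≡ p + length rest
      split = trans (length-∖ uniq (orbit-unique fixₚ (free (here refl)))
          λ y∈ → let (i , _ , eq) = ∈-applyUpTo⁻ (fold x f) y∈ in
            subst (_∈ xs) (sym eq) (closed-fold closed (here refl) i))
        (cong (_+ length rest) (length-applyUpTo (fold x f) p))
      rest≤n : length rest ≤ n
      rest≤n = s≤s⁻¹ (ℕₚ.≤-trans (ℕₚ.+-monoˡ-≤ (length rest) (>-nonZero⁻¹ p)) (subst (_≤ suc n) split len≤n))

-- Finite fields

module Field {q : ℕ} (F : FieldOn q) where
  open FieldOn F public

  ring : CommutativeRing 0ℓ 0ℓ
  ring = record { isCommutativeRing = isCommutativeRing }

  open CommutativeRing ring public
    using (+-assoc; +-comm; +-identityˡ; +-identityʳ; -‿inverseʳ; *-assoc; *-comm; *-identityˡ; zeroˡ; zeroʳ)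
  open Algebra.Properties.Ring (CommutativeRing.ring ring) using (-‿distribˡ-*; -‿distribʳ-*)
  open Algebra.Properties.AbelianGroup (CommutativeRing.+-abelianGroup ring)
    using (⁻¹-involutive; ⁻¹-∙-comm; ε⁻¹≈ε)
  open Algebra.Properties.Semiring.Mult.TCOptimised (CommutativeRing.semiring ring) public using (1+×)
  open Algebra.Properties.Semiring.Mult.TCOptimised (CommutativeRing.semiring ring)
    using (×-homo-+; ×1-homo-*) renaming (_×_ to _×′_)

  -- Integer coefficients let the ring solver compute with numerals. The optimised multiple sends 0
  -- and 1 to `0F` and `1F` definitionally, so `con (+ 1)` matches `1F` in a goal.
  ⟦_⟧ℤ : ℤ → Fin q
  ⟦ + n ⟧ℤ      = n ×′ 1F
  ⟦ -[1+ n ] ⟧ℤ = -F (suc n ×′ 1F)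

  private
    R = fromCommutativeRing ring

    neg-homo : ∀ i → ⟦ ℤ.- i ⟧ℤ ≡ -F ⟦ i ⟧ℤ
    neg-homo (+ zero)   = sym ε⁻¹≈ε
    neg-homo (+ suc n)  = refl
    neg-homo (-[1+ n ]) = sym (⁻¹-involutive _)

    ⊖-homo : ∀ m n → ⟦ m ℤ.⊖ n ⟧ℤ ≡ (m ×′ 1F) +F (-F (n ×′ 1F))
    ⊖-homo m zero = sym (trans (cong (m ×′ 1F +F_) ε⁻¹≈ε) (+-identityʳ _))
    ⊖-homo zero (suc n) = sym (+-identityˡ _)
    ⊖-homo (suc m) (suc n) = begin
      ⟦ suc m ℤ.⊖ suc n ⟧ℤ ≡⟨ cong ⟦_⟧ℤ (ℤₚ.[1+m]⊖[1+n]≡m⊖n m n) ⟩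
      ⟦ m ℤ.⊖ n ⟧ℤ ≡⟨ ⊖-homo m n ⟩
      x +F (-F y) ≡⟨ cong (_+F (-F y)) (sym (+-identityʳ x)) ⟩
      x +F 0F +F (-F y) ≡⟨ cong (λ z → x +F z +F (-F y)) (sym (-‿inverseʳ 1F)) ⟩
      x +F (1F +F (-F 1F)) +F (-F y) ≡⟨ cong (_+F (-F y)) (sym (+-assoc x 1F (-F 1F))) ⟩
      x +F 1F +F (-F 1F) +F (-F y) ≡⟨ +-assoc (x +F 1F) (-F 1F) (-F y) ⟩
      x +F 1F +F (-F 1F +F (-F y)) ≡⟨ cong₂ _+F_ (+-comm x 1F) (⁻¹-∙-comm 1F y) ⟩
      1F +F x +F (-F (1F +F y)) ≡⟨ cong₂ (λ s t → s +F (-F t)) (sym (1+× m 1F)) (sym (1+× n 1F)) ⟩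
      (suc m ×′ 1F) +F (-F (suc n ×′ 1F)) ∎
      where
      open ≡-Reasoning
      x = m ×′ 1F
      y = n ×′ 1F

    plus-homo : ∀ i j → ⟦ i ℤ.+ j ⟧ℤ ≡ ⟦ i ⟧ℤ +F ⟦ j ⟧ℤ
    plus-homo (+ m)      (+ n)      = ×-homo-+ 1F m n
    plus-homo (+ m)      (-[1+ n ]) = ⊖-homo m (suc n)
    plus-homo (-[1+ m ]) (+ n)      = trans (⊖-homo n (suc m)) (+-comm _ _)
    plus-homo (-[1+ m ]) (-[1+ n ]) = begin
      -F (suc (suc (m ℕ.+ n)) ×′ 1F) ≡⟨ cong (λ k → -F (k ×′ 1F)) (sym (ℕₚ.+-suc (suc m) n)) ⟩
      -F ((suc m ℕ.+ suc n) ×′ 1F) ≡⟨ cong -F_ (×-homo-+ 1F (suc m) (suc n)) ⟩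
      -F ((suc m ×′ 1F) +F (suc n ×′ 1F)) ≡⟨ sym (⁻¹-∙-comm _ _) ⟩
      -F (suc m ×′ 1F) +F (-F (suc n ×′ 1F)) ∎
      where open ≡-Reasoning

    pos-times-homo : ∀ m n → ⟦ + m ℤ.* + n ⟧ℤ ≡ ⟦ + m ⟧ℤ *F ⟦ + n ⟧ℤ
    pos-times-homo m n = trans (cong ⟦_⟧ℤ (sym (ℤₚ.pos-* m n))) (×1-homo-* m n)

    times-pos-homo : ∀ i n → ⟦ i ℤ.* + n ⟧ℤ ≡ ⟦ i ⟧ℤ *F ⟦ + n ⟧ℤ
    times-pos-homo (+ m)      n = pos-times-homo m n
    times-pos-homo (-[1+ m ]) n = begin
      ⟦ ℤ.- (+ suc m) ℤ.* + n ⟧ℤ ≡⟨ cong ⟦_⟧ℤ (sym (ℤₚ.neg-distribˡ-* (+ suc m) (+ n))) ⟩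
      ⟦ ℤ.- (+ suc m ℤ.* + n) ⟧ℤ ≡⟨ neg-homo (+ suc m ℤ.* + n) ⟩
      -F ⟦ + suc m ℤ.* + n ⟧ℤ ≡⟨ cong -F_ (pos-times-homo (suc m) n) ⟩
      -F (⟦ + suc m ⟧ℤ *F ⟦ + n ⟧ℤ) ≡⟨ -‿distribˡ-* _ _ ⟩
      -F ⟦ + suc m ⟧ℤ *F ⟦ + n ⟧ℤ ∎
      where open ≡-Reasoning

    times-homo : ∀ i j → ⟦ i ℤ.* j ⟧ℤ ≡ ⟦ i ⟧ℤ *F ⟦ j ⟧ℤ
    times-homo i (+ n)      = times-pos-homo i n
    times-homo i (-[1+ n ]) = begin
      ⟦ i ℤ.* ℤ.- (+ suc n) ⟧ℤ ≡⟨ cong ⟦_⟧ℤ (sym (ℤₚ.neg-distribʳ-* i (+ suc n))) ⟩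
      ⟦ ℤ.- (i ℤ.* + suc n) ⟧ℤ ≡⟨ neg-homo (i ℤ.* + suc n) ⟩
      -F ⟦ i ℤ.* + suc n ⟧ℤ ≡⟨ cong -F_ (times-pos-homo i (suc n)) ⟩
      -F (⟦ i ⟧ℤ *F ⟦ + suc n ⟧ℤ) ≡⟨ -‿distribʳ-* _ _ ⟩
      ⟦ i ⟧ℤ *F -F ⟦ + suc n ⟧ℤ ∎
      where open ≡-Reasoning

    ℤ-homo : ℤ.+-*-rawRing -Raw-AlmostCommutative⟶ R
    ℤ-homo = record
      { ⟦_⟧ = ⟦_⟧ℤ ; +-homo = plus-homo ; *-homo = times-homo ; -‿homo = neg-homo
      ; 0-homo = refl ; 1-homo = refl }

    coefficient≟ : ∀ i j → Maybe (⟦ i ⟧ℤ ≡ ⟦ j ⟧ℤ)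
    coefficient≟ i j = Maybe.map (cong ⟦_⟧ℤ) (dec⇒maybe (i ℤₚ.≟ j))

  open Algebra.Solver.Ring ℤ.+-*-rawRing R ℤ-homo coefficient≟ public
    using (Polynomial; solve; _:=_; _:+_; _:*_; _:-_; :-_; con)

  infixl 6 _-F_
  _-F_ : Fin q → Fin q → Fin q
  x -F y = x +F (-F y)

  x-y≡0⇒x≡y : ∀ {x y} → x -F y ≡ 0F → x ≡ y
  x-y≡0⇒x≡y {x} {y} eq = trans (trans (solve 2 (λ x y → x := (x :- y) :+ y) refl x y) (cong (_+F y) eq)) (+-identityˡ y)

  x≡y⇒x-y≡0 : ∀ {x y} → x ≡ y → x -F y ≡ 0F
  x≡y⇒x-y≡0 {x} refl = -‿inverseʳ x

  multiple : ∀ {l r} k → l ≡ r → k *F (l -F r) ≡ 0F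
  multiple k eq = trans (cong (k *F_) (x≡y⇒x-y≡0 eq)) (zeroʳ k)

  -- An equation x = y certified by exhibiting x - y as a linear combination of
  -- differences l - r of equations l = r that are already known.
  by₁ : ∀ {x y k l r} → l ≡ r → x -F y ≡ k *F (l -F r) → x ≡ y
  by₁ {k = k} e eq = x-y≡0⇒x≡y (trans eq (multiple k e))

  by₂ : ∀ {x y k₁ l₁ r₁ k₂ l₂ r₂} → l₁ ≡ r₁ → l₂ ≡ r₂ →
        x -F y ≡ k₁ *F (l₁ -F r₁) +F k₂ *F (l₂ -F r₂) → x ≡ y
  by₂ {k₁ = k₁} {k₂ = k₂} e₁ e₂ eq = x-y≡0⇒x≡y (trans eq
    (trans (cong₂ _+F_ (multiple k₁ e₁) (multiple k₂ e₂)) (+-identityˡ 0F)))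

  by₃ : ∀ {x y k₁ l₁ r₁ k₂ l₂ r₂ k₃ l₃ r₃} → l₁ ≡ r₁ → l₂ ≡ r₂ → l₃ ≡ r₃ →
        x -F y ≡ k₁ *F (l₁ -F r₁) +F k₂ *F (l₂ -F r₂) +F k₃ *F (l₃ -F r₃) → x ≡ y
  by₃ {k₁ = k₁} {k₂ = k₂} {k₃ = k₃} e₁ e₂ e₃ eq = x-y≡0⇒x≡y (trans eq
    (trans (cong₂ _+F_ (trans (cong₂ _+F_ (multiple k₁ e₁) (multiple k₂ e₂)) (+-identityˡ 0F)) (multiple k₃ e₃))
      (+-identityˡ 0F)))

  *-cancelˡ : ∀ {a x y} → a ≢ 0F → a *F x ≡ a *F y → x ≡ y
  *-cancelˡ {a} {x} {y} a≢0 eq with inverse a a≢0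
  ... | b , ab≡1 = by₂ eq ab≡1
    (solve 4 (λ a b x y → x :- y := b :* (a :* x :- a :* y) :+ (y :- x) :* (a :* b :- con (+ 1))) refl a b x y)

  *≡0⇒≡0 : ∀ {a x} → a ≢ 0F → a *F x ≡ 0F → x ≡ 0F
  *≡0⇒≡0 {a} a≢0 eq = *-cancelˡ a≢0 (trans eq (sym (zeroʳ a)))

  *≢0 : ∀ {a b} → a ≢ 0F → b ≢ 0F → a *F b ≢ 0F
  *≢0 a≢0 b≢0 ab≡0 = b≢0 (*≡0⇒≡0 a≢0 ab≡0)

abstract
  prime-2 : Prime 2
  prime-2 = from-yes (prime? 2)

  prime-3 : Prime 3
  prime-3 = from-yes (prime? 3)

  prime-5 : Prime 5
  prime-5 = from-yes (prime? 5)

-- Counting arguments in a finite field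

module FieldCounting {q : ℕ} (F : FieldOn q) where
  open Field F public

  private
    module R₁ = Removal {Fin q} _≟_

    _≟₂_ = ≡-dec {A = Fin q} {B = λ _ → Fin q} _≟_ _≟_

    module R₂ = Removal _≟₂_

    elements : List (Fin q)
    elements = allFin q

    length-elements : length elements ≡ q
    length-elements = length-tabulate {n = q} _

    plane-unique : Unique (cartesianProduct elements elements)
    plane-unique = Unique.cartesianProduct⁺ (Unique.allFin⁺ q) (Unique.allFin⁺ q)

  -- Translation by 1 has no fixed point, and its p-th iterate is translation by p = 0, so the q
  -- field elements fall into orbits of size p.
  characteristic∣ : ∀ {p} → Prime p → ⟦ + p ⟧ℤ ≡ 0F → p ∣ q
  characteristic∣ {p} p-prime p≡0 = subst (p ∣_) length-elements
    (free⇒p∣length (Unique.allFin⁺ q) (λ _ → ∈-allFin _) (λ {x} _ → periodic x) (λ {x} _ → free x))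
    where
    open CyclicAction _≟_ p-prime (1F +F_)
    translate : ∀ x k → fold x (1F +F_) k ≡ ⟦ + k ⟧ℤ +F x
    translate x zero = sym (+-identityˡ x)
    translate x (suc k) = trans (cong (1F +F_) (translate x k))
      (trans (sym (+-assoc 1F _ x)) (cong (_+F x) (sym (1+× k 1F))))
    periodic : ∀ x → fold x (1F +F_) p ≡ x
    periodic x = trans (translate x p) (trans (cong (_+F x) p≡0) (+-identityˡ x))
    free : ∀ x → 1F +F x ≢ x
    free x eq = 0≢1 (sym (by₁ eq (solve 1 (λ x → con (+ 1) :- con (+ 0) := con (+ 1) :* (con (+ 1) :+ x :- x)) refl x)))

  characteristic≢ : ∀ {p} → Prime p → .{{_ : ℕ.NonZero p}} → q % p ≢ 0 → ⟦ + p ⟧ℤ ≢ 0F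
  characteristic≢ {p} p-prime q%p≢0 p≡0 = q%p≢0 (n∣m⇒m%n≡0 q p (characteristic∣ p-prime p≡0))

  -- Multiplication by w would permute the q - 1 units in free orbits of size 3, so q ≡ 1 modulo 3.
  -- Freeness means w ≠ 1, and w = 1 would give 3 = 0, hence 3 | q.
  no-cube-root-of-unity : q % 3 ≡ 2 → ∀ w → w *F w +F w +F 1F ≢ 0F
  no-cube-root-of-unity q%3≡2 w w²+w+1≡0 = absurd (free⇒p∣length unique closed
      (λ {x} _ → by₁ w²+w+1≡0 (solve 2 (λ w x → w :* (w :* (w :* x)) :- x :=
        ((w :- con (+ 1)) :* x) :* (w :* w :+ w :+ con (+ 1) :- con (+ 0))) refl w x))
      λ x∈ wx≡x → 1≢w (*-cancelˡ (nonzero x∈) (trans (*-comm _ 1F) (trans (*-identityˡ _) (trans (sym wx≡x) (*-comm w _))))))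
    where
    open CyclicAction _≟_ prime-3 (w *F_)
    units = elements R₁.- 0F
    unique : Unique units
    unique = R₁.∖-unique (0F ∷ []) (Unique.allFin⁺ q)
    nonzero : ∀ {x} → x ∈ units → x ≢ 0F
    nonzero x∈ x≡0 = proj₂ (R₁.∈-∖⁻ {xs = elements} (0F ∷ []) x∈) (here x≡0)
    w≢0 : w ≢ 0F
    w≢0 refl = 0≢1 (by₁ w²+w+1≡0 (solve 0 (con (+ 0) :- con (+ 1) :=
      con (ℤ.- (+ 1)) :* (con (+ 0) :* con (+ 0) :+ con (+ 0) :+ con (+ 1) :- con (+ 0))) refl))
    closed : Closed units
    closed x∈ = R₁.∈-∖⁺ {xs = elements} (0F ∷ []) (∈-allFin _)
      λ { (here wx≡0) → *≢0 w≢0 (nonzero x∈) wx≡0 }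
    1≢w : 1F ≢ w
    1≢w refl = characteristic≢ prime-3 (λ q%3≡0 → case trans (sym q%3≡2) q%3≡0 of λ ())
      (by₁ w²+w+1≡0 (solve 0 (con (+ 3) :- con (+ 0) :=
        con (+ 1) :* (con (+ 1) :* con (+ 1) :+ con (+ 1) :+ con (+ 1) :- con (+ 0))) refl))
    absurd : ¬ (3 ∣ length units)
    absurd (divides k eq) with trans (sym q%3≡2) (trans (cong (_% 3) q≡) ([m+kn]%n≡m%n 1 k 3))
      where
      q≡ : q ≡ 1 ℕ.+ k ℕ.* 3
      q≡ = trans (sym length-elements) (trans (R₁.length-removal (Unique.allFin⁺ q) (∈-allFin 0F)) (cong suc eq))
    ... | ()

  -- The roots of s² + s - 1 are (-1 ± √5) / 2; for odd q one exists exactly when 5 is a square.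
  Golden : Fin q → Set
  Golden s = s *F s ≡ 1F -F s

  golden? : Dec (∃[ s ] Golden s)
  golden? = Finₚ.any? λ s → s *F s ≟ 1F -F s

  -- The pentagon recurrence x₀ x₂ = 1 - x₁ has period 5 on the pairs with all entries
  -- nonzero, its constant solutions are the golden elements, and there are (q - 2)(q - 3) such pairs.
  module Pentagon where

    -- The map f below has to be defined on all pairs, so 0 receives the arbitrary inverse 0;
    -- solutions have nonzero entries only.
    totalInverse : ∀ x → ∃[ y ] (x ≢ 0F → x *F y ≡ 1F)
    totalInverse x with x ≟ 0F
    ... | yes x≡0 = 0F , λ x≢0 → ⊥-elim (x≢0 x≡0)
    ... | no x≢0 = let (y , xy≡1) = inverse x x≢0 in y , λ _ → xy≡1

    abstract
      inv : Fin q → Fin q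
      inv x = proj₁ (totalInverse x)

      inv-inverse : ∀ {x} → x ≢ 0F → x *F inv x ≡ 1F
      inv-inverse {x} = proj₂ (totalInverse x)

    f : Fin q × Fin q → Fin q × Fin q
    f (s , r) = r , (1F -F r) *F inv s

    recurrence : ∀ {s} r → s ≢ 0F → s *F ((1F -F r) *F inv s) ≡ 1F -F r
    recurrence {s} r s≢0 = by₁ (inv-inverse s≢0)
      (solve 3 (λ s r i → s :* ((con (+ 1) :- r) :* i) :- (con (+ 1) :- r) := (con (+ 1) :- r) :* (s :* i :- con (+ 1))) refl s r (inv s))

    Admissible : Fin q → Set
    Admissible x = x ≢ 0F × x ≢ 1F

    admissible : List (Fin q)
    admissible = elements R₁.∖ (0F ∷ 1F ∷ [])

    pairs : List (Fin q × Fin q)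
    pairs = cartesianProduct admissible admissible

    antidiagonal : List (Fin q × Fin q)
    antidiagonal = map (λ s → s , 1F -F s) admissible

    solutions : List (Fin q × Fin q)
    solutions = pairs R₂.∖ antidiagonal

    Solution : Fin q × Fin q → Set
    Solution (s , r) = Admissible s × Admissible r × s +F r ≢ 1F

    ∈-admissible⁺ : ∀ {x} → Admissible x → x ∈ admissible
    ∈-admissible⁺ (x≢0 , x≢1) = R₁.∈-∖⁺ {xs = elements} (0F ∷ 1F ∷ []) (∈-allFin _)
      λ { (here x≡0) → x≢0 x≡0 ; (there (here x≡1)) → x≢1 x≡1 }

    ∈-admissible⁻ : ∀ {x} → x ∈ admissible → Admissible x
    ∈-admissible⁻ x∈ = let x∉ = proj₂ (R₁.∈-∖⁻ {xs = elements} (0F ∷ 1F ∷ []) x∈) in x∉ ∘ here , x∉ ∘ there ∘ here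

    ∈-solutions⁺ : ∀ {x} → Solution x → x ∈ solutions
    ∈-solutions⁺ (s-adm , r-adm , s+r≢1) = R₂.∈-∖⁺ antidiagonal
      (∈-cartesianProduct⁺ (∈-admissible⁺ s-adm) (∈-admissible⁺ r-adm))
      λ x∈ → let (t , _ , eq) = ∈-map⁻ (λ s → s , 1F -F s) x∈ in
        s+r≢1 (trans (cong₂ _+F_ (cong proj₁ eq) (cong proj₂ eq))
                     (solve 1 (λ t → t :+ (con (+ 1) :- t) := con (+ 1)) refl t))

    ∈-solutions⁻ : ∀ {x} → x ∈ solutions → Solution x
    ∈-solutions⁻ {s , r} x∈ with R₂.∈-∖⁻ {xs = pairs} antidiagonal x∈
    ... | x∈pairs , x∉ with ∈-cartesianProduct⁻ admissible admissible x∈pairs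
    ... | s∈ , r∈ = ∈-admissible⁻ s∈ , ∈-admissible⁻ r∈ , λ s+r≡1 →
      x∉ (subst (λ t → (s , t) ∈ antidiagonal)
        (by₁ s+r≡1 (solve 2 (λ s r → (con (+ 1) :- s) :- r := con (ℤ.- (+ 1)) :* (s :+ r :- con (+ 1))) refl s r))
        (∈-map⁺ (λ s → s , 1F -F s) s∈))

    -- The conditions rotate. With t the next term, r ≠ 1 yields t ≠ 0, s + r ≠ 1 yields t ≠ 1, and
    -- s ≠ 1 yields r + t ≠ 1.
    f-solution : ∀ {x} → Solution x → Solution (f x)
    f-solution {s , r} ((s≢0 , s≢1) , (r≢0 , r≢1) , s+r≢1) = (r≢0 , r≢1) , (t≢0 , t≢1) , r+t≢1
      where
      t = proj₂ (f (s , r))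
      st≡1-r : s *F t ≡ 1F -F r
      st≡1-r = recurrence r s≢0
      t≢0 : t ≢ 0F
      t≢0 t≡0 = r≢1 (by₂ st≡1-r t≡0 (solve 3 (λ s r t → r :- con (+ 1) :=
        con (+ 1) :* (s :* t :- (con (+ 1) :- r)) :+ (:- s) :* (t :- con (+ 0))) refl s r t))
      t≢1 : t ≢ 1F
      t≢1 t≡1 = s+r≢1 (by₂ st≡1-r t≡1 (solve 3 (λ s r t → s :+ r :- con (+ 1) :=
        con (+ 1) :* (s :* t :- (con (+ 1) :- r)) :+ (:- s) :* (t :- con (+ 1))) refl s r t))
      r+t≢1 : r +F t ≢ 1F
      r+t≢1 r+t≡1 = s≢1 (*-cancelˡ t≢0 (by₂ st≡1-r r+t≡1 (solve 3 (λ s r t → t :* s :- t :* con (+ 1) :=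
        con (+ 1) :* (s :* t :- (con (+ 1) :- r)) :+ (:- con (+ 1)) :* (r :+ t :- con (+ 1))) refl s r t)))

    -- With indices modulo 5, the relations centred at 1, 2 and 3 imply those centred at 0 and 4. Up
    -- to the sign of the variables this is Lyness's 5-cycle.
    closing : ∀ x₀ x₁ x₂ x₃ x₄ → x₁ ≢ 0F → 1F -F x₁ ≢ 0F →
      x₀ *F x₂ ≡ 1F -F x₁ → x₁ *F x₃ ≡ 1F -F x₂ → x₂ *F x₄ ≡ 1F -F x₃ →
      x₄ *F x₁ ≡ 1F -F x₀ × x₃ *F x₀ ≡ 1F -F x₄
    closing x₀ x₁ x₂ x₃ x₄ x₁≢0 1-x₁≢0 e₁ e₂ e₃ = e₅ , e₄
      where
      e₅ : x₄ *F x₁ ≡ 1F -F x₀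
      e₅ = *-cancelˡ 1-x₁≢0 (by₃ e₁ e₂ e₃ (solve 5 (λ x₀ x₁ x₂ x₃ x₄ →
          (con (+ 1) :- x₁) :* (x₄ :* x₁) :- (con (+ 1) :- x₁) :* (con (+ 1) :- x₀) :=
          (con (+ 1) :- x₁ :* x₄) :* (x₀ :* x₂ :- (con (+ 1) :- x₁))
          :+ (:- x₀) :* (x₁ :* x₃ :- (con (+ 1) :- x₂))
          :+ (x₀ :* x₁) :* (x₂ :* x₄ :- (con (+ 1) :- x₃))) refl x₀ x₁ x₂ x₃ x₄))
      e₄ : x₃ *F x₀ ≡ 1F -F x₄
      e₄ = *-cancelˡ x₁≢0 (by₃ e₁ e₂ e₅ (solve 5 (λ x₀ x₁ x₂ x₃ x₄ →
          x₁ :* (x₃ :* x₀) :- x₁ :* (con (+ 1) :- x₄) :=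
          (:- con (+ 1)) :* (x₀ :* x₂ :- (con (+ 1) :- x₁))
          :+ x₀ :* (x₁ :* x₃ :- (con (+ 1) :- x₂))
          :+ con (+ 1) :* (x₄ :* x₁ :- (con (+ 1) :- x₀))) refl x₀ x₁ x₂ x₃ x₄))

    -- By `closing`, x₀ and x₁ satisfy the linear equations that define x₅ and x₆, whose leading
    -- coefficients x₃ and x₄ are nonzero.
    f-period : ∀ {x} → Solution x → fold x f 5 ≡ x
    f-period {x₀ , x₁} sol₀@((x₀≢0 , _) , (x₁≢0 , x₁≢1) , _) = cong₂ _,_ x₅≡x₀ x₆≡x₁
      where
      sol₁ = f-solution sol₀
      sol₂ = f-solution sol₁
      sol₃ = f-solution sol₂
      x₂ = proj₂ (f (x₀ , x₁))
      x₃ = proj₂ (f (x₁ , x₂))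
      x₄ = proj₂ (f (x₂ , x₃))
      x₅ = proj₂ (f (x₃ , x₄))
      x₆ = proj₂ (f (x₄ , x₅))
      x₂≢0 = proj₁ (proj₁ (proj₂ sol₁))
      x₃≢0 = proj₁ (proj₁ (proj₂ sol₂))
      x₄≢0 = proj₁ (proj₁ (proj₂ sol₃))
      e₁ : x₀ *F x₂ ≡ 1F -F x₁
      e₁ = recurrence x₁ x₀≢0
      e₂ : x₁ *F x₃ ≡ 1F -F x₂
      e₂ = recurrence x₂ x₁≢0
      e₃ : x₂ *F x₄ ≡ 1F -F x₃
      e₃ = recurrence x₃ x₂≢0
      1-x₁≢0 : 1F -F x₁ ≢ 0F
      1-x₁≢0 eq = x₁≢1 (sym (x-y≡0⇒x≡y eq))
      e₅ = proj₁ (closing x₀ x₁ x₂ x₃ x₄ x₁≢0 1-x₁≢0 e₁ e₂ e₃)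
      e₄ = proj₂ (closing x₀ x₁ x₂ x₃ x₄ x₁≢0 1-x₁≢0 e₁ e₂ e₃)
      x₅≡x₀ : x₅ ≡ x₀
      x₅≡x₀ = *-cancelˡ x₃≢0 (trans (recurrence x₄ x₃≢0) (sym e₄))
      x₆≡x₁ : x₆ ≡ x₁
      x₆≡x₁ = *-cancelˡ x₄≢0 (trans (recurrence x₅ x₄≢0) (trans (cong (λ x → 1F -F x) x₅≡x₀) (sym e₅)))

    fixed⇒golden : ∀ {s r} → Solution (s , r) → f (s , r) ≡ (s , r) → Golden s
    fixed⇒golden {s} {r} ((s≢0 , _) , _) eq with cong proj₁ eq
    ... | refl = trans (cong (s *F_) (sym (cong proj₂ eq))) (recurrence s s≢0)

    unique-pairs : Unique pairs
    unique-pairs = Unique.cartesianProduct⁺ unique unique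
      where unique = R₁.∖-unique (0F ∷ 1F ∷ []) (Unique.allFin⁺ q)

    q≡2+admissible : q ≡ 2 ℕ.+ length admissible
    q≡2+admissible = trans (sym length-elements)
      (R₁.length-∖ (Unique.allFin⁺ q) ((0≢1 ∷ []) ∷ [] ∷ []) λ _ → ∈-allFin _)

    admissible²≡admissible+solutions : let m = length admissible in m ℕ.* m ≡ m ℕ.+ length solutions
    admissible²≡admissible+solutions = begin
      length admissible ℕ.* length admissible ≡⟨ sym (length-cartesianProduct admissible admissible) ⟩
      length pairs ≡⟨ R₂.length-∖ unique-pairs
        (Unique.map⁺ (cong proj₁) (R₁.∖-unique (0F ∷ 1F ∷ []) (Unique.allFin⁺ q))) antidiagonal⊆ ⟩
      length antidiagonal ℕ.+ length solutions ≡⟨ cong (ℕ._+ length solutions) (length-map _ admissible) ⟩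
      length admissible ℕ.+ length solutions ∎
      where
      open ≡-Reasoning
      antidiagonal⊆ : ∀ {x} → x ∈ antidiagonal → x ∈ pairs
      antidiagonal⊆ x∈ with ∈-map⁻ (λ s → s , 1F -F s) x∈
      ... | s , s∈ , refl = ∈-cartesianProduct⁺ s∈ (∈-admissible⁺
        ( (λ e → proj₂ (∈-admissible⁻ s∈) (sym (x-y≡0⇒x≡y e)))
        , (λ e → proj₁ (∈-admissible⁻ s∈) (by₁ e (solve 1 (λ s → s :- con (+ 0) :=
            (:- con (+ 1)) :* (con (+ 1) :- s :- con (+ 1))) refl s)))))

    5∣solutions : ¬ (∃[ s ] Golden s) → 5 ∣ length solutions
    5∣solutions no-golden = free⇒p∣length {solutions} (R₂.∖-unique antidiagonal unique-pairs)
      (λ {x} x∈ → ∈-solutions⁺ {f x} (f-solution {x} (∈-solutions⁻ {x} x∈)))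
      (λ {x} x∈ → f-period {x} (∈-solutions⁻ {x} x∈))
      λ {x} x∈ fixed → no-golden (proj₁ x , fixed⇒golden {proj₁ x} {proj₂ x} (∈-solutions⁻ {x} x∈) fixed)
      where open CyclicAction _≟₂_ prime-5 f

    -- A fixed solution would be golden, so here the action is free and 5 divides (q - 2)(q - 3).
    no-golden⇒q≡±2 : ¬ (∃[ s ] Golden s) → q % 5 ≡ 2 ⊎ q % 5 ≡ 3
    no-golden⇒q≡±2 no-golden = residue (length admissible) q≡2+admissible admissible²≡admissible+solutions
      where
      residue : ∀ m → q ≡ 2 ℕ.+ m → m ℕ.* m ≡ m ℕ.+ length solutions → q % 5 ≡ 2 ⊎ q % 5 ≡ 3
      residue zero q≡2 _ = inj₁ (cong (_% 5) q≡2)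
      -- Here q - 2 = k + 1, and cancelling k + 1 from the count leaves k (k + 1) solutions.
      residue (suc k) q≡ count = [ (λ 5∣k → inj₂ (mod 3 k q≡ 5∣k)) , (λ 5∣k+1 → inj₁ (mod 2 (suc k) q≡ 5∣k+1)) ]′
        (euclidsLemma k (suc k) prime-5
          (subst (5 ∣_) (sym (ℕₚ.+-cancelˡ-≡ (suc k) _ _ count)) (5∣solutions no-golden)))
        where
        mod : ∀ r m → q ≡ r ℕ.+ m → 5 ∣ m → q % 5 ≡ r % 5
        mod r m q≡r+m (divides j m≡5j) = trans (cong (_% 5) (trans q≡r+m (cong (r ℕ.+_) m≡5j))) ([m+kn]%n≡m%n r j 5)

  open Pentagon public using (no-golden⇒q≡±2)

  -- The companion matrix of x² - s x + 1 has order 5 for golden s.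
  golden⇒q²≡1 : ∀ {s} → Golden s → ⟦ + 5 ⟧ℤ ≢ 0F → (q ℕ.* q) % 5 ≡ 1
  golden⇒q²≡1 {s} golden 5≢0 = residue (free⇒p∣length {vectors} (R₂.∖-unique ((0F , 0F) ∷ []) plane-unique)
      (λ {x} → closed {x}) (λ {x} _ → period x) (λ {x} → free {x}))
    where
    f : Fin q × Fin q → Fin q × Fin q
    f (a , b) = -F b , a +F s *F b
    open CyclicAction _≟₂_ prime-5 f
    vectors = cartesianProduct elements elements R₂.- (0F , 0F)
    nonzero : ∀ {x} → x ∈ vectors → x ≢ (0F , 0F)
    nonzero x∈ x≡0 = proj₂ (R₂.∈-∖⁻ {xs = cartesianProduct elements elements} ((0F , 0F) ∷ []) x∈) (here x≡0)
    kernel : ∀ a b → f (a , b) ≡ (0F , 0F) → (a , b) ≡ (0F , 0F)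
    kernel a b eq = cong₂ _,_
      (by₂ (cong proj₁ eq) (cong proj₂ eq) (solve 3 (λ a b s → a :- con (+ 0) :=
        s :* (:- b :- con (+ 0)) :+ con (+ 1) :* (a :+ s :* b :- con (+ 0))) refl a b s))
      (by₁ (cong proj₁ eq) (solve 1 (λ b → b :- con (+ 0) := (:- con (+ 1)) :* (:- b :- con (+ 0))) refl b))
    closed : Closed vectors
    closed {a , b} x∈ = R₂.∈-∖⁺ {xs = cartesianProduct elements elements} ((0F , 0F) ∷ [])
      (∈-cartesianProduct⁺ (∈-allFin _) (∈-allFin _)) λ { (here eq) → nonzero x∈ (kernel a b eq) }
    period : ∀ x → fold x f 5 ≡ x
    period (a , b) = cong₂ _,_
      (by₁ golden (solve 3 (λ a b s →
        let a₁ = :- b ; b₁ = a :+ s :* b ; a₂ = :- b₁ ; b₂ = a₁ :+ s :* b₁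
            a₃ = :- b₂ ; b₃ = a₂ :+ s :* b₂ ; a₄ = :- b₃ ; b₄ = a₃ :+ s :* b₃
        in :- b₄ :- a := (b :- s :* a :- s :* (s :* b) :+ a :+ s :* b) :* (s :* s :- (con (+ 1) :- s))) refl a b s))
      (by₁ golden (solve 3 (λ a b s →
        let a₁ = :- b ; b₁ = a :+ s :* b ; a₂ = :- b₁ ; b₂ = a₁ :+ s :* b₁
            a₃ = :- b₂ ; b₃ = a₂ :+ s :* b₂ ; a₄ = :- b₃ ; b₄ = a₃ :+ s :* b₃
        in a₄ :+ s :* b₄ :- b := (a :* (s :* s :- s :- con (+ 1)) :+ b :* (s :* s :* s :- s :* s :- con (+ 2) :* s :+ con (+ 1)))
           :* (s :* s :- (con (+ 1) :- s))) refl a b s))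
    -- A fixed vector makes 1 a root of x² - s x + 1, so s = 2; but 2 is golden only if 5 = 0.
    free : Free vectors
    free {a , b} x∈ fixed = 5≢0 5≡0
      where
      a≡ : -F b ≡ a
      a≡ = cong proj₁ fixed
      b≡ : a +F s *F b ≡ b
      b≡ = cong proj₂ fixed
      b≢0 : b ≢ 0F
      b≢0 b≡0 = nonzero x∈ (cong₂ _,_ (by₂ a≡ b≡0 (solve 2 (λ a b → a :- con (+ 0) :=
        (:- con (+ 1)) :* (:- b :- a) :+ (:- con (+ 1)) :* (b :- con (+ 0))) refl a b)) b≡0)
      s≡2 : s ≡ ⟦ + 2 ⟧ℤ
      s≡2 = *-cancelˡ b≢0 (by₂ a≡ b≡ (solve 3 (λ a b s → b :* s :- b :* con (+ 2) :=
        con (+ 1) :* (:- b :- a) :+ con (+ 1) :* (a :+ s :* b :- b)) refl a b s))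
      5≡0 : ⟦ + 5 ⟧ℤ ≡ 0F
      5≡0 = by₂ golden s≡2 (solve 1 (λ s → con (+ 5) :- con (+ 0) :=
        con (+ 1) :* (s :* s :- (con (+ 1) :- s)) :+ (:- (s :+ con (+ 3))) :* (s :- con (+ 2))) refl s)
    residue : 5 ∣ length vectors → (q ℕ.* q) % 5 ≡ 1
    residue (divides k eq) = trans (cong (_% 5) q²≡) ([m+kn]%n≡m%n 1 k 5)
      where
      q²≡ : q ℕ.* q ≡ 1 ℕ.+ k ℕ.* 5
      q²≡ = trans (sym (trans (length-cartesianProduct elements elements) (cong₂ ℕ._*_ length-elements length-elements)))
        (trans (R₂.length-removal plane-unique (∈-cartesianProduct⁺ (∈-allFin 0F) (∈-allFin 0F))) (cong suc eq))

  -- A golden element would give q² ≡ 1 modulo 5, whereas (±2)² ≡ 4.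
  q≡±2⇒no-golden : q % 5 ≡ 2 ⊎ q % 5 ≡ 3 → ¬ (∃[ s ] Golden s)
  q≡±2⇒no-golden q≡±2 (s , golden) = contradictory q≡±2
      (trans (sym (%-distribˡ-* q q 5)) (golden⇒q²≡1 golden (characteristic≢ prime-5 (q%5≢0 q≡±2))))
    where
    q%5≢0 : q % 5 ≡ 2 ⊎ q % 5 ≡ 3 → q % 5 ≢ 0
    q%5≢0 (inj₁ eq) rewrite eq = λ ()
    q%5≢0 (inj₂ eq) rewrite eq = λ ()
    contradictory : q % 5 ≡ 2 ⊎ q % 5 ≡ 3 → ((q % 5) ℕ.* (q % 5)) % 5 ≢ 1
    contradictory (inj₁ eq) rewrite eq = λ ()
    contradictory (inj₂ eq) rewrite eq = λ ()

  square-injective : ∀ {x y} → x *F x ≡ y *F y → x ≢ y → x ≡ -F y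
  square-injective {x} {y} x²≡y² x≢y = x-y≡0⇒x≡y (*≡0⇒≡0 (x≢y ∘ x-y≡0⇒x≡y)
    (by₁ x²≡y² (solve 2 (λ x y → (x :- y) :* (x :- :- y) :- con (+ 0) :=
      con (+ 1) :* (x :* x :- y :* y)) refl x y)))

  SumOfTwoSquares : Fin q → Set
  SumOfTwoSquares c = ∃[ u ] ∃[ v ] (u *F u +F v *F v ≡ c)

  -- Squaring is injective on the x that precede -x, and so is x ↦ c - x² on the others;
  -- adding the value c - 0² gives q + 1 values in a field of q elements.
  sum-of-two-squares : ∀ c → SumOfTwoSquares c
  sum-of-two-squares c = let (i , j , i<j , eq) = pigeonhole (ℕₚ.n<1+n q) value in collision i j i<j eq
    where
    Small : Fin q → Set
    Small x = toℕ x ℕ.≤ toℕ (-F x)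

    small? : ∀ x → Dec (Small x)
    small? x = toℕ x ℕₚ.≤? toℕ (-F x)

    select : ∀ {x} → Dec (Small x) → Fin q
    select {x} (yes _) = x *F x
    select {x} (no _)  = c -F x *F x

    value : Fin (suc q) → Fin q
    value zero    = c
    value (suc x) = select (small? x)

    c≡square : ∀ {x} → c ≡ x *F x → SumOfTwoSquares c
    c≡square {x} eq = x , 0F , by₁ eq (solve 2 (λ x c → x :* x :+ con (+ 0) :* con (+ 0) :- c :=
      (:- con (+ 1)) :* (c :- x :* x)) refl x c)

    sum : ∀ {x y} → x *F x ≡ c -F y *F y → SumOfTwoSquares c
    sum {x} {y} eq = x , y , by₁ eq (solve 3 (λ x y c → x :* x :+ y :* y :- c :=
      con (+ 1) :* (x :* x :- (c :- y :* y))) refl x y c)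

    neg-swap : ∀ {x y} → x ≡ -F y → -F x ≡ y
    neg-swap {x} {y} eq = by₁ eq (solve 2 (λ x y → :- x :- y := (:- con (+ 1)) :* (x :- :- y)) refl x y)

    collision : ∀ i j → i Fin.< j → value i ≡ value j → SumOfTwoSquares c
    collision zero (suc x) _ = at-zero (small? x)
      where
      at-zero : (d : Dec (Small x)) → c ≡ select d → SumOfTwoSquares c
      at-zero (yes _)      eq = c≡square eq
      -- The collision c = c - x² forces x = 0, but 0 = -0 is small and so contributes its square
      -- instead.
      at-zero (no ¬small) eq with x ≟ 0F
      ... | yes refl = ⊥-elim (¬small (ℕₚ.≤-reflexive (cong toℕ (solve 0 (con (+ 0) := :- con (+ 0)) refl))))
      ... | no x≢0   = ⊥-elim (*≢0 x≢0 x≢0 (by₁ eq (solve 2 (λ x c → x :* x :- con (+ 0) :=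
        con (+ 1) :* (c :- (c :- x :* x))) refl x c)))
    collision (suc x) (suc y) (s≤s x<y) = compare (small? x) (small? y)
      where
      x≢y : x ≢ y
      x≢y refl = ℕₚ.<-irrefl refl x<y
      compare : (d : Dec (Small x)) (e : Dec (Small y)) → select d ≡ select e → SumOfTwoSquares c
      compare (yes _) (no _) eq = sum eq
      compare (no _) (yes _) eq = sum (sym eq)
      -- Distinct x and y with equal squares are negatives of each other, so each would come no
      -- later than the other.
      compare (yes x-small) (yes y-small) eq = ⊥-elim (x≢y (toℕ-injective (ℕₚ.≤-antisym
        (subst (λ z → toℕ x ℕ.≤ toℕ z) (neg-swap x≡-y) x-small) (subst (λ z → toℕ y ℕ.≤ toℕ z) (sym x≡-y) y-small))))
        where x≡-y = square-injective eq x≢y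
      compare (no x-large) (no y-large) eq = ⊥-elim (ℕₚ.<-asym
        (subst (λ z → toℕ z ℕ.< toℕ x) (neg-swap x≡-y) (ℕₚ.≰⇒> x-large))
        (subst (λ z → toℕ z ℕ.< toℕ y) (sym x≡-y) (ℕₚ.≰⇒> y-large)))
        where x≡-y = square-injective (by₁ eq (solve 3 (λ x y c → x :* x :- y :* y :=
                (:- con (+ 1)) :* (c :- x :* x :- (c :- y :* y))) refl x y c)) x≢y

  module Odd (odd : q % 2 ≡ 1) where

    2≢0 : ⟦ + 2 ⟧ℤ ≢ 0F
    2≢0 = characteristic≢ prime-2 (λ q%2≡0 → case trans (sym odd) q%2≡0 of λ ())

    half : Fin q
    half = proj₁ (inverse ⟦ + 2 ⟧ℤ 2≢0)

    2half≡1 : ⟦ + 2 ⟧ℤ *F half ≡ 1F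
    2half≡1 = proj₂ (inverse ⟦ + 2 ⟧ℤ 2≢0)

    -- w = (y / c - 1) / 2 would be a primitive cube root of unity.
    -3-nonsquare : q % 3 ≡ 2 → ∀ {c y} → c ≢ 0F → y *F y +F ⟦ + 3 ⟧ℤ *F (c *F c) ≢ 0F
    -3-nonsquare q%3≡2 {c} {y} c≢0 eq with inverse c c≢0
    ... | c′ , cc′≡1 = no-cube-root-of-unity q%3≡2 (half *F (y *F c′ -F 1F))
      (by₃ eq cc′≡1 2half≡1 (solve 4 (λ h c c′ y →
        let w = h :* (y :* c′ :- con (+ 1)) in
        w :* w :+ w :+ con (+ 1) :- con (+ 0) :=
        (h :* h :* (c′ :* c′)) :* (y :* y :+ con (+ 3) :* (c :* c) :- con (+ 0))
        :+ (:- (con (+ 3) :* (h :* h) :* (c :* c′ :+ con (+ 1)))) :* (c :* c′ :- con (+ 1))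
        :+ (:- (h :* (y :* c′) :+ h :+ con (+ 1))) :* (con (+ 2) :* h :- con (+ 1))) refl half c c′ y))

    -- s = (y / 4 - 1) / 2
    5-square⇒golden : ∀ {y} → y *F y ≡ ⟦ + 80 ⟧ℤ → ∃[ s ] Golden s
    5-square⇒golden {y} eq = s , by₂ eq 2half≡1 (solve 2 (λ h y →
        let s = h :* (h :* h :* y :- con (+ 1)) ; h² = h :* h ; h³ = h² :* h ; h⁴ = h² :* h² in
        s :* s :- (con (+ 1) :- s) :=
        (h² :* h⁴) :* (y :* y :- con (+ 80))
        :+ (con (+ 40) :* (h² :* h³) :+ con (+ 20) :* h⁴ :+ con (+ 10) :* h³ :+ con (+ 5) :* h² :+ con (+ 3) :* h :+ con (+ 1) :- h³ :* y)
           :* (con (+ 2) :* h :- con (+ 1))) refl half y)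
      where s = half *F (half *F half *F y -F 1F)

-- The quadratic space of 2 × 2 matrices

module MatrixAlgebra {q : ℕ} (F : FieldOn q) where
  open FieldCounting F public
  open Matrices F public renaming (a to m₁₁; b to m₁₂; c to m₂₁; d to m₂₂)

  mat-cong : ∀ {a b c d a′ b′ c′ d′} → a ≡ a′ → b ≡ b′ → c ≡ c′ → d ≡ d′ → mat a b c d ≡ mat a′ b′ c′ d′
  mat-cong refl refl refl refl = refl

  tr : Mat → Fin q
  tr A = m₁₁ A +F m₂₂ A

  adj : Mat → Mat
  adj A = mat (m₂₂ A) (-F m₁₂ A) (-F m₂₁ A) (m₁₁ A)

  scalar : Fin q → Mat
  scalar k = mat k 0F 0F k

  1ₘ : Mat
  1ₘ = scalar 1F

  -- The polar form of det, in which det has Gram matrix of square determinant.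
  ⟨_,_⟩ : Mat → Mat → Fin q
  ⟨ A , B ⟩ = tr (adj A · B)

  det-· : ∀ A B → det (A · B) ≡ det A *F det B
  det-· (mat a b c d) (mat a′ b′ c′ d′) = solve 8 (λ a b c d a′ b′ c′ d′ →
    (a :* a′ :+ b :* c′) :* (c :* b′ :+ d :* d′) :+ :- ((a :* b′ :+ b :* d′) :* (c :* a′ :+ d :* c′)) :=
    (a :* d :+ :- (b :* c)) :* (a′ :* d′ :+ :- (b′ :* c′))) refl a b c d a′ b′ c′ d′

  det-adj : ∀ A → det (adj A) ≡ det A
  det-adj (mat a b c d) = solve 4 (λ a b c d →
    d :* a :+ :- ((:- b) :* (:- c)) := a :* d :+ :- (b :* c)) refl a b c d

  det-scalar : ∀ k → det (scalar k) ≡ k *F k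
  det-scalar k = solve 1 (λ k → k :* k :+ :- (con (+ 0) :* con (+ 0)) := k :* k) refl k

  det-1ₘ : InSL 1ₘ
  det-1ₘ = trans (det-scalar 1F) (*-identityˡ 1F)

  SL⇒GL : ∀ {A} → InSL A → InGL A
  SL⇒GL det≡1 det≡0 = 0≢1 (trans (sym det≡0) det≡1)

  GL-· : ∀ {A B} → InGL A → InGL B → InGL (A · B)
  GL-· {A} {B} A∈GL B∈GL eq = *≢0 A∈GL B∈GL (trans (sym (det-· A B)) eq)

  GL-adj : ∀ {A} → InGL A → InGL (adj A)
  GL-adj {A} A∈GL eq = A∈GL (trans (sym (det-adj A)) eq)

  SL-· : ∀ {A B} → InSL A → InSL B → InSL (A · B)
  SL-· {A} {B} A∈SL B∈SL = trans (det-· A B) (trans (cong₂ _*F_ A∈SL B∈SL) (*-identityˡ 1F))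

  SL-adj : ∀ {A} → InSL A → InSL (adj A)
  SL-adj {A} = trans (det-adj A)

  ·-adj : ∀ A → A · adj A ≡ scalar (det A)
  ·-adj (mat a b c d) = mat-cong
    (solve 4 (λ a b c d → a :* d :+ b :* (:- c) := a :* d :+ :- (b :* c)) refl a b c d)
    (solve 2 (λ a b → a :* (:- b) :+ b :* a := con (+ 0)) refl a b)
    (solve 2 (λ c d → c :* d :+ d :* (:- c) := con (+ 0)) refl c d)
    (solve 4 (λ a b c d → c :* (:- b) :+ d :* a := a :* d :+ :- (b :* c)) refl a b c d)

  adj-· : ∀ A → adj A · A ≡ scalar (det A)
  adj-· (mat a b c d) = mat-cong
    (solve 4 (λ a b c d → d :* a :+ (:- b) :* c := a :* d :+ :- (b :* c)) refl a b c d)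
    (solve 2 (λ b d → d :* b :+ (:- b) :* d := con (+ 0)) refl b d)
    (solve 2 (λ a c → (:- c) :* a :+ a :* c := con (+ 0)) refl a c)
    (solve 4 (λ a b c d → (:- c) :* b :+ a :* d := a :* d :+ :- (b :* c)) refl a b c d)

  scalar-scalar : ∀ k → Scalar (scalar k)
  scalar-scalar k = refl , refl , refl

  scalar-· : ∀ k A → scalar k · A ≡ mat (k *F m₁₁ A) (k *F m₁₂ A) (k *F m₂₁ A) (k *F m₂₂ A)
  scalar-· k (mat a b c d) = mat-cong (row k a c) (row k b d) (row′ k a c) (row′ k b d)
    where
    row : ∀ k x y → k *F x +F 0F *F y ≡ k *F x
    row = solve 3 (λ k x y → k :* x :+ con (+ 0) :* y := k :* x) refl
    row′ : ∀ k x y → 0F *F x +F k *F y ≡ k *F y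
    row′ = solve 3 (λ k x y → con (+ 0) :* x :+ k :* y := k :* y) refl

  tr-scalar-· : ∀ k A → tr (scalar k · A) ≡ k *F tr A
  tr-scalar-· k (mat a b c d) = solve 5 (λ k a b c d →
    (k :* a :+ con (+ 0) :* c) :+ (con (+ 0) :* b :+ k :* d) := k :* (a :+ d)) refl k a b c d

  pairing-self : ∀ A → ⟨ A , A ⟩ ≡ ⟦ + 2 ⟧ℤ *F det A
  pairing-self (mat a b c d) = solve 4 (λ a b c d →
    (d :* a :+ (:- b) :* c) :+ ((:- c) :* b :+ a :* d) := con (+ 2) :* (a :* d :+ :- (b :* c))) refl a b c d

  pairing-sym : ∀ A B → ⟨ A , B ⟩ ≡ ⟨ B , A ⟩
  pairing-sym (mat a b c d) (mat a′ b′ c′ d′) = solve 8 (λ a b c d a′ b′ c′ d′ →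
    (d :* a′ :+ (:- b) :* c′) :+ ((:- c) :* b′ :+ a :* d′) :=
    (d′ :* a :+ (:- b′) :* c) :+ ((:- c′) :* b :+ a′ :* d)) refl a b c d a′ b′ c′ d′

  pairing-1ₘ : ∀ A → ⟨ 1ₘ , A ⟩ ≡ tr A
  pairing-1ₘ (mat a b c d) = solve 4 (λ a b c d →
    (con (+ 1) :* a :+ (:- con (+ 0)) :* c) :+ ((:- con (+ 0)) :* b :+ con (+ 1) :* d) := a :+ d) refl a b c d

  -- Left multiplication by `adj M` is a similitude of det with factor det M. This allows one member
  -- of a clique to be moved to the identity while the pairings change by signs only.
  pairing-scaled-translate : ∀ e f M A B →
    ⟨ scalar e · (adj M · A) , scalar f · (adj M · B) ⟩ ≡ e *F f *F det M *F ⟨ A , B ⟩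
  pairing-scaled-translate e f M A B = begin
    ⟨ scalar e · A′ , scalar f · B′ ⟩ ≡⟨ bilinear e f A′ B′ ⟩
    e *F f *F ⟨ A′ , B′ ⟩             ≡⟨ cong (e *F f *F_) (translate M A B) ⟩
    e *F f *F (det M *F ⟨ A , B ⟩)    ≡⟨ sym (*-assoc (e *F f) (det M) _) ⟩
    e *F f *F det M *F ⟨ A , B ⟩      ∎
    where
    open ≡-Reasoning
    A′ = adj M · A
    B′ = adj M · B
    bilinear : ∀ e f A B → ⟨ scalar e · A , scalar f · B ⟩ ≡ e *F f *F ⟨ A , B ⟩
    bilinear e f A B = trans (cong₂ ⟨_,_⟩ (scalar-· e A) (scalar-· f B)) (solve 10 (λ e f a b c d a′ b′ c′ d′ →
      ((e :* d) :* (f :* a′) :+ (:- (e :* b)) :* (f :* c′)) :+ ((:- (e :* c)) :* (f :* b′) :+ (e :* a) :* (f :* d′)) :=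
      e :* f :* ((d :* a′ :+ (:- b) :* c′) :+ ((:- c) :* b′ :+ a :* d′))) refl
      e f (m₁₁ A) (m₁₂ A) (m₂₁ A) (m₂₂ A) (m₁₁ B) (m₁₂ B) (m₂₁ B) (m₂₂ B))
    translate : ∀ M A B → ⟨ adj M · A , adj M · B ⟩ ≡ det M *F ⟨ A , B ⟩
    translate (mat m₁ m₂ m₃ m₄) (mat a b c d) (mat a′ b′ c′ d′) = solve 12 (λ m₁ m₂ m₃ m₄ a b c d a′ b′ c′ d′ →
      let x₁ = m₄ :* a :+ (:- m₂) :* c ; x₂ = m₄ :* b :+ (:- m₂) :* d
          x₃ = (:- m₃) :* a :+ m₁ :* c ; x₄ = (:- m₃) :* b :+ m₁ :* d
          y₁ = m₄ :* a′ :+ (:- m₂) :* c′ ; y₂ = m₄ :* b′ :+ (:- m₂) :* d′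
          y₃ = (:- m₃) :* a′ :+ m₁ :* c′ ; y₄ = (:- m₃) :* b′ :+ m₁ :* d′
      in (x₄ :* y₁ :+ (:- x₂) :* y₃) :+ ((:- x₃) :* y₂ :+ x₁ :* y₄) :=
         (m₁ :* m₄ :+ :- (m₂ :* m₃)) :* ((d :* a′ :+ (:- b) :* c′) :+ ((:- c) :* b′ :+ a :* d′)))
      refl m₁ m₂ m₃ m₄ a b c d a′ b′ c′ d′

  -- By Cayley-Hamilton, A³ = (t² - 1) A - t. So t² - 1 annihilates both off-diagonal entries of A
  -- and the difference of its diagonal entries, not all of which vanish.
  scalar-cube⇒trace²≡1 : ∀ {A} → InSL A → ¬ Scalar A → Scalar (A · (A · A)) → tr A *F tr A ≡ 1F
  scalar-cube⇒trace²≡1 {A@(mat a b c d)} det≡1 ¬scalar (b³≡0 , c³≡0 , a³≡d³) with tr A *F tr A ≟ 1F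
  ... | yes t²≡1 = t²≡1
  ... | no t²≢1 = ⊥-elim (¬scalar (*≡0⇒≡0 t²-1≢0 eb , *≡0⇒≡0 t²-1≢0 ec , x-y≡0⇒x≡y (*≡0⇒≡0 t²-1≢0 ea)))
    where
    t²-1≢0 : tr A *F tr A -F 1F ≢ 0F
    t²-1≢0 = t²≢1 ∘ x-y≡0⇒x≡y
    eb : (tr A *F tr A -F 1F) *F b ≡ 0F
    eb = by₂ b³≡0 det≡1 (solve 4 (λ a b c d →
      let t = a :+ d ; a₂ = a :* a :+ b :* c ; b₂ = a :* b :+ b :* d ; c₂ = c :* a :+ d :* c ; d₂ = c :* b :+ d :* d in
      (t :* t :- con (+ 1)) :* b :- con (+ 0) :=
      con (+ 1) :* (a :* b₂ :+ b :* d₂ :- con (+ 0)) :+ b :* (a :* d :+ :- (b :* c) :- con (+ 1))) refl a b c d)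
    ec : (tr A *F tr A -F 1F) *F c ≡ 0F
    ec = by₂ c³≡0 det≡1 (solve 4 (λ a b c d →
      let t = a :+ d ; a₂ = a :* a :+ b :* c ; b₂ = a :* b :+ b :* d ; c₂ = c :* a :+ d :* c ; d₂ = c :* b :+ d :* d in
      (t :* t :- con (+ 1)) :* c :- con (+ 0) :=
      con (+ 1) :* (c :* a₂ :+ d :* c₂ :- con (+ 0)) :+ c :* (a :* d :+ :- (b :* c) :- con (+ 1))) refl a b c d)
    ea : (tr A *F tr A -F 1F) *F (a -F d) ≡ 0F
    ea = by₂ a³≡d³ det≡1 (solve 4 (λ a b c d →
      let t = a :+ d ; a₂ = a :* a :+ b :* c ; b₂ = a :* b :+ b :* d ; c₂ = c :* a :+ d :* c ; d₂ = c :* b :+ d :* d in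
      (t :* t :- con (+ 1)) :* (a :- d) :- con (+ 0) :=
      con (+ 1) :* (a :* a₂ :+ b :* c₂ :- (c :* b₂ :+ d :* d₂)) :+ (a :- d) :* (a :* d :+ :- (b :* c) :- con (+ 1))) refl a b c d)

  -- The companion matrix of x² - x + 1, which represents the class of determinant 1 and trace 1.
  companion : Mat
  companion = mat 0F (-F 1F) 1F 1F

  -- The columns are e₁ and A e₁.
  krylov : Mat → Mat
  krylov A = mat 1F (m₁₁ A) 0F (m₂₁ A)

  -- In the basis e₁, A e₁ the identity A² = A - 1 turns A into the companion matrix. The form A P =
  -- P C avoids inverting P.
  krylov-conjugates : ∀ {A} → InSL A → tr A ≡ 1F → A · krylov A ≡ krylov A · companion
  krylov-conjugates {mat a b c d} det≡1 tr≡1 = mat-cong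
    (solve 2 (λ a b → a :* con (+ 1) :+ b :* con (+ 0) := con (+ 1) :* con (+ 0) :+ a :* con (+ 1)) refl a b)
    (by₂ det≡1 tr≡1 (solve 4 (λ a b c d →
      a :* a :+ b :* c :- (con (+ 1) :* (:- con (+ 1)) :+ a :* con (+ 1)) :=
      (:- con (+ 1)) :* (a :* d :+ :- (b :* c) :- con (+ 1)) :+ a :* (a :+ d :- con (+ 1))) refl a b c d))
    (solve 2 (λ c d → c :* con (+ 1) :+ d :* con (+ 0) := con (+ 0) :* con (+ 0) :+ c :* con (+ 1)) refl c d)
    (by₁ tr≡1 (solve 3 (λ a c d →
      c :* a :+ d :* c :- (con (+ 0) :* (:- con (+ 1)) :+ c :* con (+ 1)) := c :* (a :+ d :- con (+ 1))) refl a c d))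

  det-krylov : ∀ A → det (krylov A) ≡ m₂₁ A
  det-krylov (mat a b c d) = solve 2 (λ a c → con (+ 1) :* c :+ :- (a :* con (+ 0)) := c) refl a c

  sign : ∀ {e} → e *F e ≡ 1F → e ≡ 1F ⊎ e ≡ -F 1F
  sign {e} e²≡1 with e ≟ 1F
  ... | yes e≡1 = inj₁ e≡1
  ... | no e≢1  = inj₂ (square-injective (trans e²≡1 (sym (*-identityˡ 1F))) e≢1)

  det₃ : (a b c d e f g h i : Fin q) → Fin q
  det₃ a b c d e f g h i = a *F (e *F i -F f *F h) -F b *F (d *F i -F f *F g) +F c *F (d *F h -F e *F g)

  det₃-cong : ∀ {a b c d e f g h i a′ b′ c′ d′ e′ f′ g′ h′ i′} →
    a ≡ a′ → b ≡ b′ → c ≡ c′ → d ≡ d′ → e ≡ e′ → f ≡ f′ → g ≡ g′ → h ≡ h′ → i ≡ i′ →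
    det₃ a b c d e f g h i ≡ det₃ a′ b′ c′ d′ e′ f′ g′ h′ i′
  det₃-cong refl refl refl refl refl refl refl refl refl = refl

  -- Coordinates of the trace-zero matrix 2 x - tr x.
  ξ₁ ξ₂ ξ₃ : Mat → Fin q
  ξ₁ x = m₁₁ x -F m₂₂ x
  ξ₂ x = ⟦ + 2 ⟧ℤ *F m₁₂ x
  ξ₃ x = ⟦ + 2 ⟧ℤ *F m₂₁ x

  volume : Mat → Mat → Mat → Fin q
  volume x y z = det₃ (ξ₁ x) (ξ₂ x) (ξ₃ x) (ξ₁ y) (ξ₂ y) (ξ₃ y) (ξ₁ z) (ξ₂ z) (ξ₃ z)

  polar : (x₁ x₂ x₃ y₁ y₂ y₃ : Fin q) → Fin q
  polar x₁ x₂ x₃ y₁ y₂ y₃ = -F (⟦ + 2 ⟧ℤ *F (x₁ *F y₁) +F x₂ *F y₃ +F x₃ *F y₂)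

  -- The pairing of 2 x - tr x and 2 y - tr y.
  β : Mat → Mat → Fin q
  β x y = ⟦ + 4 ⟧ℤ *F ⟨ x , y ⟩ -F ⟦ + 2 ⟧ℤ *F (tr x *F tr y)

  polar≡β : ∀ x y → polar (ξ₁ x) (ξ₂ x) (ξ₃ x) (ξ₁ y) (ξ₂ y) (ξ₃ y) ≡ β x y
  polar≡β (mat a b c d) (mat a′ b′ c′ d′) = solve 8 (λ a b c d a′ b′ c′ d′ →
    :- (con (+ 2) :* ((a :- d) :* (a′ :- d′)) :+ (con (+ 2) :* b) :* (con (+ 2) :* c′) :+ (con (+ 2) :* c) :* (con (+ 2) :* b′)) :=
    con (+ 4) :* ((d :* a′ :+ (:- b) :* c′) :+ ((:- c) :* b′ :+ a :* d′)) :- con (+ 2) :* ((a :+ d) :* (a′ :+ d′)))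
    refl a b c d a′ b′ c′ d′

  -- This is det (P J Qᵀ) = det P · det J · det Q, where P has rows x, y, z, Q has rows x, y, w, and
  -- J, the matrix of `polar`, has determinant 2.
  gram-polar : ∀ x₁ x₂ x₃ y₁ y₂ y₃ z₁ z₂ z₃ w₁ w₂ w₃ →
    ⟦ + 2 ⟧ℤ *F (det₃ x₁ x₂ x₃ y₁ y₂ y₃ z₁ z₂ z₃ *F det₃ x₁ x₂ x₃ y₁ y₂ y₃ w₁ w₂ w₃) ≡
    det₃ (polar x₁ x₂ x₃ x₁ x₂ x₃) (polar x₁ x₂ x₃ y₁ y₂ y₃) (polar x₁ x₂ x₃ w₁ w₂ w₃)
         (polar y₁ y₂ y₃ x₁ x₂ x₃) (polar y₁ y₂ y₃ y₁ y₂ y₃) (polar y₁ y₂ y₃ w₁ w₂ w₃)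
         (polar z₁ z₂ z₃ x₁ x₂ x₃) (polar z₁ z₂ z₃ y₁ y₂ y₃) (polar z₁ z₂ z₃ w₁ w₂ w₃)
  gram-polar = solve 12 (λ x₁ x₂ x₃ y₁ y₂ y₃ z₁ z₂ z₃ w₁ w₂ w₃ →
    let det₃ = λ a b c d e f g h i → a :* (e :* i :- f :* h) :- b :* (d :* i :- f :* g) :+ c :* (d :* h :- e :* g)
        polar = λ x₁ x₂ x₃ y₁ y₂ y₃ → :- (con (+ 2) :* (x₁ :* y₁) :+ x₂ :* y₃ :+ x₃ :* y₂)
    in con (+ 2) :* (det₃ x₁ x₂ x₃ y₁ y₂ y₃ z₁ z₂ z₃ :* det₃ x₁ x₂ x₃ y₁ y₂ y₃ w₁ w₂ w₃) :=
       det₃ (polar x₁ x₂ x₃ x₁ x₂ x₃) (polar x₁ x₂ x₃ y₁ y₂ y₃) (polar x₁ x₂ x₃ w₁ w₂ w₃)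
            (polar y₁ y₂ y₃ x₁ x₂ x₃) (polar y₁ y₂ y₃ y₁ y₂ y₃) (polar y₁ y₂ y₃ w₁ w₂ w₃)
            (polar z₁ z₂ z₃ x₁ x₂ x₃) (polar z₁ z₂ z₃ y₁ y₂ y₃) (polar z₁ z₂ z₃ w₁ w₂ w₃)) refl

  -- Volumes are thus controlled by traces and pairings alone. Taking w = z gives a squared volume;
  -- a different w compares two volumes over the same x, y.
  gram : ∀ x y z w → ⟦ + 2 ⟧ℤ *F (volume x y z *F volume x y w) ≡
    det₃ (β x x) (β x y) (β x w) (β y x) (β y y) (β y w) (β z x) (β z y) (β z w)
  gram x y z w = trans
    (gram-polar (ξ₁ x) (ξ₂ x) (ξ₃ x) (ξ₁ y) (ξ₂ y) (ξ₃ y) (ξ₁ z) (ξ₂ z) (ξ₃ z) (ξ₁ w) (ξ₂ w) (ξ₃ w))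
    (det₃-cong (polar≡β x x) (polar≡β x y) (polar≡β x w) (polar≡β y x) (polar≡β y y) (polar≡β y w)
               (polar≡β z x) (polar≡β z y) (polar≡β z w))

-- Sets of matrices with all pairings ±1

module Cliques {q : ℕ} (F : FieldOn q) (odd : q % 2 ≡ 1) (q≡2 : q % 3 ≡ 2) where
  open MatrixAlgebra F public
  open Odd odd public

  3≢0 : ⟦ + 3 ⟧ℤ ≢ 0F
  3≢0 = characteristic≢ prime-3 (λ q≡0 → case trans (sym q≡2) q≡0 of λ ())

  4≢0 : ⟦ + 4 ⟧ℤ ≢ 0F
  4≢0 eq = *≢0 2≢0 2≢0 (trans (solve 0 (con (+ 2) :* con (+ 2) := con (+ 4)) refl) eq)

  12≢0 : ⟦ + 12 ⟧ℤ ≢ 0F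
  12≢0 eq = *≢0 4≢0 3≢0 (trans (solve 0 (con (+ 4) :* con (+ 3) := con (+ 12)) refl) eq)

  -- If c = 0 then a d = 1 and (a - d)² = (a + d)² - 4 = -3 would be a square.
  m₂₁≢0 : ∀ {A} → InSL A → tr A *F tr A ≡ 1F → m₂₁ A ≢ 0F
  m₂₁≢0 {mat a b c d} det≡1 t²≡1 c≡0 = -3-nonsquare q≡2 {1F} {a -F d} (0≢1 ∘ sym)
    (by₃ det≡1 t²≡1 c≡0 (solve 4 (λ a b c d →
      (a :- d) :* (a :- d) :+ con (+ 3) :* (con (+ 1) :* con (+ 1)) :- con (+ 0) :=
      con -[1+ 3 ] :* (a :* d :+ :- (b :* c) :- con (+ 1)) :+ con (+ 1) :* ((a :+ d) :* (a :+ d) :- con (+ 1))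
      :+ (con -[1+ 3 ] :* b) :* (c :- con (+ 0))) refl a b c d))

  _⌢_ : Mat → Mat → Set
  A ⌢ B = ⟨ A , B ⟩ *F ⟨ A , B ⟩ ≡ 1F

  Normal : Mat → Set
  Normal x = InSL x × tr x ≡ 1F

  -- Translation by M⁻¹ followed by the choice of sign giving trace 1.
  normalise : Mat → Mat → Mat
  normalise M A = scalar ⟨ M , A ⟩ · (adj M · A)

  normalise-normal : ∀ {M A} → InSL M → InSL A → M ⌢ A → Normal (normalise M A)
  normalise-normal {M} {A} M∈SL A∈SL M⌢A =
    SL-· {scalar ⟨ M , A ⟩} (trans (det-scalar _) M⌢A) (SL-· {adj M} (SL-adj {M} M∈SL) A∈SL) ,
    trans (tr-scalar-· _ (adj M · A)) M⌢A

  normalise-⌢ : ∀ {M A B} → InSL M → M ⌢ A → M ⌢ B → A ⌢ B → normalise M A ⌢ normalise M B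
  normalise-⌢ {M} {A} {B} M∈SL M⌢A M⌢B A⌢B = trans (cong (λ z → z *F z) (pairing-scaled-translate e f M A B))
    (identity e f (det M) ⟨ A , B ⟩ M∈SL M⌢A M⌢B A⌢B)
    where
    e = ⟨ M , A ⟩
    f = ⟨ M , B ⟩
    identity : ∀ e f m k → m ≡ 1F → e *F e ≡ 1F → f *F f ≡ 1F → k *F k ≡ 1F →
               (e *F f *F m *F k) *F (e *F f *F m *F k) ≡ 1F
    identity e f m k refl e² f² k² = by₃ e² f² k² (solve 3 (λ e f k →
      (e :* f :* con (+ 1) :* k) :* (e :* f :* con (+ 1) :* k) :- con (+ 1) :=
      (f :* f :* (k :* k)) :* (e :* e :- con (+ 1)) :+ (k :* k) :* (f :* f :- con (+ 1)) :+ con (+ 1) :* (k :* k :- con (+ 1)))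
      refl e f k)

  β-self : ∀ {x} → Normal x → β x x ≡ ⟦ + 6 ⟧ℤ
  β-self {x} (det≡1 , tr≡1) rewrite pairing-self x | det≡1 | tr≡1 =
    solve 0 (con (+ 4) :* (con (+ 2) :* con (+ 1)) :- con (+ 2) :* (con (+ 1) :* con (+ 1)) := con (+ 6)) refl

  β-positive : ∀ {x y} → Normal x → Normal y → ⟨ x , y ⟩ ≡ 1F → β x y ≡ ⟦ + 2 ⟧ℤ
  β-positive (_ , trx≡1) (_ , try≡1) pos rewrite pos | trx≡1 | try≡1 =
    solve 0 (con (+ 4) :* con (+ 1) :- con (+ 2) :* (con (+ 1) :* con (+ 1)) := con (+ 2)) refl

  β-negative : ∀ {x y} → Normal x → Normal y → ⟨ x , y ⟩ ≡ -F 1F → β x y ≡ ⟦ -[1+ 5 ] ⟧ℤ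
  β-negative (_ , trx≡1) (_ , try≡1) neg rewrite neg | trx≡1 | try≡1 =
    solve 0 (con (+ 4) :* (:- con (+ 1)) :- con (+ 2) :* (con (+ 1) :* con (+ 1)) := con -[1+ 5 ]) refl

  β-sym : ∀ x y → β x y ≡ β y x
  β-sym x y = cong₂ (λ s t → ⟦ + 4 ⟧ℤ *F s -F ⟦ + 2 ⟧ℤ *F t) (pairing-sym x y) (*-comm (tr x) (tr y))

  volume² : ∀ {x y z R S T} → Normal x → Normal y → Normal z →
    β x y ≡ ⟦ R ⟧ℤ → β x z ≡ ⟦ S ⟧ℤ → β y z ≡ ⟦ T ⟧ℤ →
    ⟦ + 2 ⟧ℤ *F (volume x y z *F volume x y z) ≡
    det₃ ⟦ + 6 ⟧ℤ ⟦ R ⟧ℤ ⟦ S ⟧ℤ ⟦ R ⟧ℤ ⟦ + 6 ⟧ℤ ⟦ T ⟧ℤ ⟦ S ⟧ℤ ⟦ T ⟧ℤ ⟦ + 6 ⟧ℤ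
  volume² {x} {y} {z} nx ny nz R S T = trans (gram x y z z)
    (det₃-cong (β-self {x} nx) R S (trans (β-sym y x) R) (β-self {y} ny) T (trans (β-sym z x) S) (trans (β-sym z y) T) (β-self {z} nz))

  module _ {x y z : Mat} (nx : Normal x) (ny : Normal y) (nz : Normal z) where

    private
      v = volume x y z

    one-or-two-negative : v *F v +F ⟦ + 3 ⟧ℤ *F (⟦ + 4 ⟧ℤ *F ⟦ + 4 ⟧ℤ) ≢ 0F
    one-or-two-negative = -3-nonsquare q≡2 4≢0

    three-negative : v *F v +F ⟦ + 3 ⟧ℤ *F (⟦ + 12 ⟧ℤ *F ⟦ + 12 ⟧ℤ) ≢ 0F
    three-negative = -3-nonsquare q≡2 12≢0

    -- The Gram determinant of 1, x, y, z is 5, -3 or -27 according to the signs of the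
    -- pairings, and it is a square, whereas -3 is not.
    positive : x ⌢ y → x ⌢ z → y ⌢ z →
      ⟨ x , y ⟩ ≡ 1F × ⟨ x , z ⟩ ≡ 1F × ⟨ y , z ⟩ ≡ 1F × v *F v ≡ ⟦ + 80 ⟧ℤ
    positive x⌢y x⌢z y⌢z = cases (sign x⌢y) (sign x⌢z) (sign y⌢z)
      where
      pxy = β-positive {x} {y} nx ny
      pxz = β-positive {x} {z} nx nz
      pyz = β-positive {y} {z} ny nz
      nxy = β-negative {x} {y} nx ny
      nxz = β-negative {x} {z} nx nz
      nyz = β-negative {y} {z} ny nz
      V : ∀ {R S T} → β x y ≡ ⟦ R ⟧ℤ → β x z ≡ ⟦ S ⟧ℤ → β y z ≡ ⟦ T ⟧ℤ → _
      V {R} {S} {T} = volume² {x} {y} {z} {R} {S} {T} nx ny nz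
      -- The squared volume is 16 times the Gram determinant of 1, x, y, z. One or two negative
      -- signs give v² = -96 / 2 = -3 · 4²; three give v² = -864 / 2 = -3 · 12².
      -48≡ : ∀ {D} → D ≡ ⟦ -[1+ 95 ] ⟧ℤ → ⟦ + 2 ⟧ℤ *F (v *F v) ≡ D → ⊥
      -48≡ refl e = one-or-two-negative (*-cancelˡ 2≢0 (by₁ e (solve 1 (λ v →
        con (+ 2) :* (v :* v :+ con (+ 3) :* (con (+ 4) :* con (+ 4))) :- con (+ 2) :* con (+ 0) :=
        con (+ 1) :* (con (+ 2) :* (v :* v) :- con -[1+ 95 ])) refl v)))
      :num : ∀ (R S T : ℤ) → Polynomial 0
      :num R S T = con (+ 6) :* (con (+ 6) :* con (+ 6) :- con T :* con T) :- con R :* (con R :* con (+ 6) :- con T :* con S)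
                   :+ con S :* (con R :* con T :- con (+ 6) :* con S)
      cases : ⟨ x , y ⟩ ≡ 1F ⊎ ⟨ x , y ⟩ ≡ -F 1F → ⟨ x , z ⟩ ≡ 1F ⊎ ⟨ x , z ⟩ ≡ -F 1F →
              ⟨ y , z ⟩ ≡ 1F ⊎ ⟨ y , z ⟩ ≡ -F 1F →
              ⟨ x , y ⟩ ≡ 1F × ⟨ x , z ⟩ ≡ 1F × ⟨ y , z ⟩ ≡ 1F × v *F v ≡ ⟦ + 80 ⟧ℤ
      cases (inj₁ r) (inj₁ s) (inj₁ t) = r , s , t , *-cancelˡ 2≢0
        (trans (V {+ 2} {+ 2} {+ 2} (pxy r) (pxz s) (pyz t))
               (solve 0 (:num (+ 2) (+ 2) (+ 2) := con (+ 2) :* con (+ 80)) refl))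
      cases (inj₂ r) (inj₁ s) (inj₁ t) = ⊥-elim (-48≡ (solve 0 (:num -[1+ 5 ] (+ 2) (+ 2) := con -[1+ 95 ]) refl)
        (V { -[1+ 5 ]} {+ 2} {+ 2} (nxy r) (pxz s) (pyz t)))
      cases (inj₁ r) (inj₂ s) (inj₁ t) = ⊥-elim (-48≡ (solve 0 (:num (+ 2) -[1+ 5 ] (+ 2) := con -[1+ 95 ]) refl)
        (V {+ 2} { -[1+ 5 ]} {+ 2} (pxy r) (nxz s) (pyz t)))
      cases (inj₁ r) (inj₁ s) (inj₂ t) = ⊥-elim (-48≡ (solve 0 (:num (+ 2) (+ 2) -[1+ 5 ] := con -[1+ 95 ]) refl)
        (V {+ 2} {+ 2} { -[1+ 5 ]} (pxy r) (pxz s) (nyz t)))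
      cases (inj₂ r) (inj₂ s) (inj₁ t) = ⊥-elim (-48≡ (solve 0 (:num -[1+ 5 ] -[1+ 5 ] (+ 2) := con -[1+ 95 ]) refl)
        (V { -[1+ 5 ]} { -[1+ 5 ]} {+ 2} (nxy r) (nxz s) (pyz t)))
      cases (inj₂ r) (inj₁ s) (inj₂ t) = ⊥-elim (-48≡ (solve 0 (:num -[1+ 5 ] (+ 2) -[1+ 5 ] := con -[1+ 95 ]) refl)
        (V { -[1+ 5 ]} {+ 2} { -[1+ 5 ]} (nxy r) (pxz s) (nyz t)))
      cases (inj₁ r) (inj₂ s) (inj₂ t) = ⊥-elim (-48≡ (solve 0 (:num (+ 2) -[1+ 5 ] -[1+ 5 ] := con -[1+ 95 ]) refl)
        (V {+ 2} { -[1+ 5 ]} { -[1+ 5 ]} (pxy r) (nxz s) (nyz t)))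
      cases (inj₂ r) (inj₂ s) (inj₂ t) = ⊥-elim (three-negative (*-cancelˡ 2≢0 (by₁
        (trans (V { -[1+ 5 ]} { -[1+ 5 ]} { -[1+ 5 ]} (nxy r) (nxz s) (nyz t))
               (solve 0 (:num -[1+ 5 ] -[1+ 5 ] -[1+ 5 ] := con -[1+ 863 ]) refl))
        (solve 1 (λ v →
          con (+ 2) :* (v :* v :+ con (+ 3) :* (con (+ 12) :* con (+ 12))) :- con (+ 2) :* con (+ 0) :=
          con (+ 1) :* (con (+ 2) :* (v :* v) :- con -[1+ 863 ])) refl v))))

  -- All pairings being 1, the volumes V = vol(x,y,z) and W = vol(x,y,w) satisfy
  -- V² = W² = 80 and V W = 16, but 80² ≠ 16².
  no-five : ∀ {x y z w} → Normal x → Normal y → Normal z → Normal w →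
    x ⌢ y → x ⌢ z → x ⌢ w → y ⌢ z → y ⌢ w → z ⌢ w → ⊥
  no-five {x} {y} {z} {w} nx ny nz nw xy xz xw yz yw zw
    with positive {x} {y} {z} nx ny nz xy xz yz | positive {x} {y} {w} nx ny nw xy xw yw | positive {x} {z} {w} nx nz nw xz xw zw
  ... | pxy , pxz , pyz , v² | _ , pxw , pyw , u² | _ , _ , pzw , _ = contradictory (volume x y z) (volume x y w) v² u²
    (*-cancelˡ 2≢0 (trans (gram x y z w) (trans (det₃-cong
      (β-self {x} nx) (β-positive {x} {y} nx ny pxy) (β-positive {x} {w} nx nw pxw)
      (trans (β-sym y x) (β-positive {x} {y} nx ny pxy)) (β-self {y} ny) (β-positive {y} {w} ny nw pyw)
      (trans (β-sym z x) (β-positive {x} {z} nx nz pxz)) (trans (β-sym z y) (β-positive {y} {z} ny nz pyz)) (β-positive {z} {w} nz nw pzw))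
      (solve 0 (con (+ 6) :* (con (+ 6) :* con (+ 2) :- con (+ 2) :* con (+ 2)) :- con (+ 2) :* (con (+ 2) :* con (+ 2) :- con (+ 2) :* con (+ 2))
        :+ con (+ 2) :* (con (+ 2) :* con (+ 2) :- con (+ 6) :* con (+ 2)) := con (+ 2) :* con (+ 16)) refl))))
    where
    16≢0 : ⟦ + 16 ⟧ℤ ≢ 0F
    16≢0 eq = *≢0 4≢0 4≢0 (trans (solve 0 (con (+ 4) :* con (+ 4) := con (+ 16)) refl) eq)
    -- 80² - 16² = 16 · 384, and the only prime factors of this number are 2 and 3.
    384≢0 : ⟦ + 16 ⟧ℤ *F (⟦ + 12 ⟧ℤ *F ⟦ + 2 ⟧ℤ) ≢ 0F
    384≢0 = *≢0 16≢0 (*≢0 12≢0 2≢0)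
    contradictory : ∀ v u → v *F v ≡ ⟦ + 80 ⟧ℤ → u *F u ≡ ⟦ + 80 ⟧ℤ → v *F u ≡ ⟦ + 16 ⟧ℤ → ⊥
    contradictory v u v² u² vu = *≢0 16≢0 384≢0 (by₃ v² u² vu (solve 2 (λ v u →
      con (+ 16) :* (con (+ 16) :* (con (+ 12) :* con (+ 2))) :- con (+ 0) :=
      (:- (u :* u)) :* (v :* v :- con (+ 80)) :+ con -[1+ 79 ] :* (u :* u :- con (+ 80))
      :+ (v :* u :+ con (+ 16)) :* (v :* u :- con (+ 16))) refl v u))

  -- Matrices from split quaternions

  module Quaternions where

    private
      -- Writing -1 as u² + v² splits the quaternion algebra: the symmetric matrix j = (u v; v -u)
      -- then has j² = -1 and anticommutes with i.
      uv : SumOfTwoSquares (-F 1F)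
      uv = sum-of-two-squares (-F 1F)

    u v : Fin q
    u = proj₁ uv
    v = proj₁ (proj₂ uv)

    u²+v²≡-1 : u *F u +F v *F v ≡ -F 1F
    u²+v²≡-1 = proj₂ (proj₂ uv)

    -- (1 + x i + y j + z k) / 2 for the quaternion basis i = (0 -1; 1 0), j = (u v; v -u), k = i j.
    quaternion : (x y z : Fin q) → Mat
    quaternion x y z = mat (half *F (1F +F y *F u -F z *F v)) (half *F (-F x +F y *F v +F z *F u))
                           (half *F (x +F y *F v +F z *F u)) (half *F (1F -F y *F u +F z *F v))

    tr-quaternion : ∀ x y z → tr (quaternion x y z) ≡ 1F
    tr-quaternion x y z = by₁ 2half≡1 (solve 6 (λ h u v x y z →
      h :* (con (+ 1) :+ y :* u :- z :* v) :+ h :* (con (+ 1) :- y :* u :+ z :* v) :- con (+ 1) :=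
      con (+ 1) :* (con (+ 2) :* h :- con (+ 1))) refl half u v x y z)

    -- The pairing is twice the Euclidean inner product of the coordinates, here 2 (1 + 1) / 4.
    pairing-quaternion : ∀ x y z x′ y′ z′ → x *F x′ +F y *F y′ +F z *F z′ ≡ 1F →
      ⟨ quaternion x y z , quaternion x′ y′ z′ ⟩ ≡ 1F
    pairing-quaternion x y z x′ y′ z′ eq = by₃ u²+v²≡-1 2half≡1 eq (solve 9 (λ h u v x y z x′ y′ z′ →
      let a = h :* (con (+ 1) :+ y :* u :- z :* v) ; b = h :* (:- x :+ y :* v :+ z :* u)
          c = h :* (x :+ y :* v :+ z :* u) ; d = h :* (con (+ 1) :- y :* u :+ z :* v)
          a′ = h :* (con (+ 1) :+ y′ :* u :- z′ :* v) ; b′ = h :* (:- x′ :+ y′ :* v :+ z′ :* u)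
          c′ = h :* (x′ :+ y′ :* v :+ z′ :* u) ; d′ = h :* (con (+ 1) :- y′ :* u :+ z′ :* v)
      in (d :* a′ :+ (:- b) :* c′) :+ ((:- c) :* b′ :+ a :* d′) :- con (+ 1) :=
         (con -[1+ 1 ] :* (h :* h) :* (y :* y′ :+ z :* z′)) :* (u :* u :+ v :* v :- :- con (+ 1))
         :+ (con (+ 2) :* h :+ con (+ 1)) :* (con (+ 2) :* h :- con (+ 1))
         :+ (con (+ 2) :* (h :* h)) :* (x :* x′ :+ y :* y′ :+ z :* z′ :- con (+ 1))) refl half u v x y z x′ y′ z′)

    det-quaternion : ∀ x y z → x *F x +F y *F y +F z *F z ≡ ⟦ + 3 ⟧ℤ → InSL (quaternion x y z)
    det-quaternion x y z eq = by₃ u²+v²≡-1 2half≡1 eq (solve 6 (λ h u v x y z →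
      let a = h :* (con (+ 1) :+ y :* u :- z :* v) ; b = h :* (:- x :+ y :* v :+ z :* u)
          c = h :* (x :+ y :* v :+ z :* u) ; d = h :* (con (+ 1) :- y :* u :+ z :* v)
      in a :* d :+ :- (b :* c) :- con (+ 1) :=
         (:- (h :* h :* (y :* y :+ z :* z))) :* (u :* u :+ v :* v :- :- con (+ 1))
         :+ (con (+ 2) :* h :+ con (+ 1)) :* (con (+ 2) :* h :- con (+ 1))
         :+ (h :* h) :* (x :* x :+ y :* y :+ z :* z :- con (+ 3))) refl half u v x y z)

-- The action on the graph

allPairs-lookup : ∀ {A : Set} {R : A → A → Set} {xs x y} → AllPairs R xs → x ∈ xs → y ∈ xs →
  x ≡ y ⊎ R x y ⊎ R y x
allPairs-lookup (_ ∷ _)  (here refl) (here refl) = inj₁ refl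
allPairs-lookup (r ∷ _)  (here refl) (there y∈)  = inj₂ (inj₁ (All.lookup r y∈))
allPairs-lookup (r ∷ _)  (there x∈)  (here refl) = inj₂ (inj₂ (All.lookup r x∈))
allPairs-lookup (_ ∷ rs) (there x∈)  (there y∈)  = allPairs-lookup rs x∈ y∈

-- A permutation of three points has order at most 3, so its cube fixes one of them.
cube-fixes : ∀ {A : Set} {g : A → A} {x y z} → Injective _≡_ _≡_ g → x ≢ y → x ≢ z → y ≢ z →
  let One = λ w → w ≡ x ⊎ w ≡ y ⊎ w ≡ z in
  One (g x) → One (g y) → One (g z) → ∃[ w ] (One w × g (g (g w)) ≡ w)
cube-fixes {g = g} {x} {y} {z} inj x≢y x≢z y≢z = go
  where
  One : _ → Set
  One w = w ≡ x ⊎ w ≡ y ⊎ w ≡ z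
  1st : One x
  1st = inj₁ refl
  2nd : One y
  2nd = inj₂ (inj₁ refl)
  3rd : One z
  3rd = inj₂ (inj₂ refl)
  fixed : ∀ {w} → One w → g w ≡ w → ∃[ w ] (One w × g (g (g w)) ≡ w)
  fixed {w} one e = w , one , trans (cong (g ∘ g) e) (trans (cong g e) e)
  cycle : ∀ {a b c} → One a → g a ≡ b → g b ≡ c → g c ≡ a → ∃[ w ] (One w × g (g (g w)) ≡ w)
  cycle {a} one e₁ e₂ e₃ = a , one , trans (cong (g ∘ g) e₁) (trans (cong g e₂) e₃)
  go : One (g x) → One (g y) → One (g z) → ∃[ w ] (One w × g (g (g w)) ≡ w)
  go (inj₁ gx) _ _ = fixed 1st gx
  go _ (inj₂ (inj₁ gy)) _ = fixed 2nd gy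
  go _ _ (inj₂ (inj₂ gz)) = fixed 3rd gz
  go (inj₂ (inj₁ gx)) (inj₂ (inj₂ gy)) (inj₁ gz) = cycle 1st gx gy gz
  go (inj₂ (inj₂ gx)) (inj₁ gy) (inj₂ (inj₁ gz)) = cycle 1st gx gz gy
  go (inj₂ (inj₁ gx)) _ (inj₂ (inj₁ gz)) = ⊥-elim (x≢z (inj (trans gx (sym gz))))
  go _ (inj₁ gy) (inj₁ gz) = ⊥-elim (y≢z (inj (trans gy (sym gz))))
  go (inj₂ (inj₂ gx)) (inj₂ (inj₂ gy)) _ = ⊥-elim (x≢y (inj (trans gx (sym gy))))

-- The order of an arc-regular group on a cubic graph

module Arcs {n : ℕ} (X : Graph n) (cubic : Cubic X) {G : PermSet n} (G⊆Aut : ∀ g → G g → IsAut X g)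
  (arcRegular : ArcRegular X G) (u₀ : Fin n) where
  open Graph X using (Adj)

  -- An arc is encoded by its tail and the number of its head among the three neighbours, which
  -- makes the count 3 n immediate.
  arcs : List (Fin n × Fin 3)
  arcs = cartesianProduct (allFin n) (allFin 3)

  neighbour : Fin n → Fin 3 → Fin n
  neighbour u i with cubic u
  neighbour u zero             | x , _ = x
  neighbour u (suc zero)       | _ , y , _ = y
  neighbour u (suc (suc zero)) | _ , _ , z , _ = z

  adjacent : ∀ u i → Adj u (neighbour u i)
  adjacent u i with cubic u
  adjacent u zero             | _ , _ , _ , u~x , _ = u~x
  adjacent u (suc zero)       | _ , _ , _ , _ , u~y , _ = u~y
  adjacent u (suc (suc zero)) | _ , _ , _ , _ , _ , u~z , _ = u~z

  neighbour-injective : ∀ u i j → neighbour u i ≡ neighbour u j → i ≡ j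
  neighbour-injective u i j eq with cubic u
  neighbour-injective u zero zero eq | _ = refl
  neighbour-injective u zero (suc zero) eq | _ , _ , _ , _ , _ , _ , x≢y , _ = ⊥-elim (x≢y eq)
  neighbour-injective u zero (suc (suc zero)) eq | _ , _ , _ , _ , _ , _ , _ , x≢z , _ = ⊥-elim (x≢z eq)
  neighbour-injective u (suc zero) zero eq | _ , _ , _ , _ , _ , _ , x≢y , _ = ⊥-elim (x≢y (sym eq))
  neighbour-injective u (suc zero) (suc zero) eq | _ = refl
  neighbour-injective u (suc zero) (suc (suc zero)) eq | _ , _ , _ , _ , _ , _ , _ , _ , y≢z , _ = ⊥-elim (y≢z eq)
  neighbour-injective u (suc (suc zero)) zero eq | _ , _ , _ , _ , _ , _ , _ , x≢z , _ = ⊥-elim (x≢z (sym eq))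
  neighbour-injective u (suc (suc zero)) (suc zero) eq | _ , _ , _ , _ , _ , _ , _ , _ , y≢z , _ = ⊥-elim (y≢z (sym eq))
  neighbour-injective u (suc (suc zero)) (suc (suc zero)) eq | _ = refl

  neighbour-surjective : ∀ u w → Adj u w → ∃[ i ] (w ≡ neighbour u i)
  neighbour-surjective u w u~w with cubic u
  ... | _ , _ , _ , _ , _ , _ , _ , _ , _ , complete with complete w u~w
  ... | inj₁ eq        = zero , eq
  ... | inj₂ (inj₁ eq) = suc zero , eq
  ... | inj₂ (inj₂ eq) = suc (suc zero) , eq

  v₀ : Fin n
  v₀ = neighbour u₀ zero

  transport : ∀ ui → ∃[ g ] (G g × g u₀ ≡ proj₁ ui × g v₀ ≡ neighbour (proj₁ ui) (proj₂ ui))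
  transport (u , i) = proj₁ arcRegular u₀ v₀ u (neighbour u i) (adjacent u₀ zero) (adjacent u i)

  element : Fin n × Fin 3 → Perm n
  element = proj₁ ∘ transport

  element-spec : ∀ ui → G (element ui) × element ui u₀ ≡ proj₁ ui × element ui v₀ ≡ neighbour (proj₁ ui) (proj₂ ui)
  element-spec = proj₂ ∘ transport

  length-arcs : length (map element arcs) ≡ n * 3
  length-arcs = trans (length-map element arcs) (trans (length-cartesianProduct (allFin n) (allFin 3))
    (cong (_* 3) (length-tabulate {n = n} id)))

  distinct : ∀ {ui vj} → ui ≢ vj → ¬ (element ui ≈ₚ element vj)
  distinct {u , i} {v , j} ui≢vj same with element-spec (u , i) | element-spec (v , j)
  ... | _ , at-u , at-i | _ , at-v , at-j with trans (sym at-u) (trans (same u₀) at-v)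
  ... | refl = ui≢vj (cong (u ,_) (neighbour-injective u i j (trans (sym at-i) (trans (same v₀) at-j))))

  G-adjacent : ∀ g → G g → Adj (g u₀) (g v₀)
  G-adjacent g g∈G = proj₁ (proj₂ (G⊆Aut g g∈G) u₀ v₀) (adjacent u₀ zero)

  index : ∀ g → G g → Fin 3
  index g g∈G = proj₁ (neighbour-surjective (g u₀) (g v₀) (G-adjacent g g∈G))

  complete : ∀ g (g∈G : G g) → g ≈ₚ element (g u₀ , index g g∈G)
  complete g g∈G with element-spec (g u₀ , index g g∈G)
  ... | e∈G , at-u₀ , at-v₀ = proj₂ arcRegular u₀ v₀ g _ (adjacent u₀ zero) g∈G e∈G (sym at-u₀)
    (trans (proj₂ (neighbour-surjective (g u₀) (g v₀) (G-adjacent g g∈G))) (sym at-v₀))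

  -- Sending g to the image of the base arc (u₀, v₀) is a bijection from G to the arcs.
  arcRegular⇒order : HasOrder G (n * 3)
  arcRegular⇒order = map element arcs , length-arcs , All.map⁺ (All.universal (proj₁ ∘ element-spec) arcs) ,
          AllPairs.map⁺ (AllPairs.map distinct (Unique.cartesianProduct⁺ (Unique.allFin⁺ n) (Unique.allFin⁺ 3))) ,
          λ g g∈G → Any.map⁺ (Any.map (λ { refl → complete g g∈G }) (∈-cartesianProduct⁺ (∈-allFin (g u₀)) (∈-allFin (index g g∈G))))

IsAut-resp-≈ₚ : ∀ {n} {X : Graph n} {σ τ : Perm n} → σ ≈ₚ τ → IsAut X σ → IsAut X τ
IsAut-resp-≈ₚ {X = X} σ≈τ (injective , preserves) =
  (λ {x} {y} eq → injective (trans (σ≈τ x) (trans eq (sym (σ≈τ y))))) ,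
  (λ u v → (λ u~v → subst₂ Adj (σ≈τ u) (σ≈τ v) (proj₁ (preserves u v) u~v)) ,
           (λ u~v → proj₂ (preserves u v) (subst₂ Adj (sym (σ≈τ u)) (sym (σ≈τ v)) u~v)))
  where open Graph X using (Adj)

-- Fixed points and intersecting sets in terms of traces

module Action
  {q : ℕ} (F : FieldOn q) (odd : q % 2 ≡ 1) (q≡2 : q % 3 ≡ 2)
  {n : ℕ} (X : Graph n) (cubic : Cubic X) (φ : Matrices.Mat F → Perm n)
  (hom : ∀ A B → Matrices.InGL F A → Matrices.InGL F B → φ (Matrices._·_ F A B) ≈ₚ (φ A ∘ φ B))
  (ker : ∀ A → Matrices.InGL F A → (φ A ≈ₚ id → Matrices.Scalar F A) × (Matrices.Scalar F A → φ A ≈ₚ id))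
  (aut : ∀ A → Matrices.InGL F A → IsAut X (φ A))
  (G : PermSet n)
  (G⇒SL : ∀ σ → G σ → ∃[ A ] (Matrices.InSL F A × φ A ≈ₚ σ))
  (SL⇒G : ∀ A → Matrices.InSL F A → G (φ A))
  (arcRegular : ArcRegular X G)
  where
  open Cliques F odd q≡2
  open Quaternions
  open Graph X using (Adj)

  Fixes : Perm n → Set
  Fixes σ = ∃[ v ] (σ v ≡ v)

  φ-scalar : ∀ {A} → InGL A → Scalar A → φ A ≈ₚ id
  φ-scalar {A} A∈GL = proj₂ (ker A A∈GL)

  φ-scalar-matrix : ∀ {k} → k ≢ 0F → φ (scalar k) ≈ₚ id
  φ-scalar-matrix {k} k≢0 = φ-scalar {scalar k} (λ eq → *≢0 k≢0 k≢0 (trans (sym (det-scalar k)) eq)) (scalar-scalar k)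

  φ-inverseˡ : ∀ {A} → InGL A → (φ (adj A) ∘ φ A) ≈ₚ id
  φ-inverseˡ {A} A∈GL v = trans (sym (hom (adj A) A (GL-adj {A} A∈GL) A∈GL v))
    (trans (cong (λ M → φ M v) (adj-· A)) (φ-scalar-matrix A∈GL v))

  φ-inverseʳ : ∀ {A} → InGL A → (φ A ∘ φ (adj A)) ≈ₚ id
  φ-inverseʳ {A} A∈GL v = trans (sym (hom A (adj A) A∈GL (GL-adj {A} A∈GL) v))
    (trans (cong (λ M → φ M v) (·-adj A)) (φ-scalar-matrix A∈GL v))

  id∈G : G (φ 1ₘ)
  id∈G = SL⇒G 1ₘ det-1ₘ

  φ-1ₘ : φ 1ₘ ≈ₚ id
  φ-1ₘ = φ-scalar-matrix (0≢1 ∘ sym)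

  shear : Mat
  shear = mat 1F 1F 0F 1F

  shear∈GL : InGL shear
  shear∈GL eq = 0≢1 (sym (trans (solve 0 (con (+ 1) := con (+ 1) :* con (+ 1) :+ :- (con (+ 1) :* con (+ 0))) refl) eq))

  -- On no points the group acts trivially, whereas the shear is not scalar.
  nonempty : ∀ m {σ : Perm m} → (σ ≈ₚ id → Scalar shear) → Fin m
  nonempty zero trivial⇒scalar = ⊥-elim (0≢1 (sym (proj₁ (trivial⇒scalar λ ()))))
  nonempty (suc m) _ = zero

  abstract
    vertex : Fin n
    vertex = nonempty n (proj₁ (ker shear shear∈GL))

  fixes-arc⇒id : ∀ {A u v} → InSL A → Adj u v → φ A u ≡ u → φ A v ≡ v → φ A ≈ₚ id
  fixes-arc⇒id {A} {u} {v} A∈SL u~v Au≡u Av≡v x = trans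
    (proj₂ arcRegular u v (φ A) (φ 1ₘ) u~v (SL⇒G A A∈SL) id∈G (trans Au≡u (sym (φ-1ₘ u))) (trans Av≡v (sym (φ-1ₘ v))) x)
    (φ-1ₘ x)

  φ-cube : ∀ {A} → InSL A → φ (A · (A · A)) ≈ₚ (φ A ∘ φ A ∘ φ A)
  φ-cube {A} A∈SL x = trans (hom A (A · A) A∈GL (GL-· {A} {A} A∈GL A∈GL) x) (cong (φ A) (hom A A A∈GL A∈GL x))
    where A∈GL = SL⇒GL {A} A∈SL

  -- A permutes the three neighbours of its fixed vertex u, so A³ fixes u and one neighbour.
  -- Regularity on arcs makes it trivial.
  fixes⇒cube≈id : ∀ {A} → InSL A → Fixes (φ A) → φ (A · (A · A)) ≈ₚ id
  fixes⇒cube≈id {A} A∈SL (u , Au≡u) with cubic u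
  ... | x , y , z , u~x , u~y , u~z , x≢y , x≢z , y≢z , complete =
    let (w , one , A³w≡w) = cube-fixes {g = φ A} (proj₁ (aut A A∈GL)) x≢y x≢z y≢z (image u~x) (image u~y) (image u~z)
    in fixes-arc⇒id {A · (A · A)} A³∈SL (adjacent one) A³u≡u (trans (φ-cube {A} A∈SL w) A³w≡w)
    where
    A∈GL = SL⇒GL {A} A∈SL
    A³∈SL = SL-· {A} {A · A} A∈SL (SL-· {A} {A} A∈SL A∈SL)
    A³u≡u : φ (A · (A · A)) u ≡ u
    A³u≡u = trans (φ-cube {A} A∈SL u) (trans (cong (φ A ∘ φ A) Au≡u) (trans (cong (φ A) Au≡u) Au≡u))
    image : ∀ {w} → Adj u w → φ A w ≡ x ⊎ φ A w ≡ y ⊎ φ A w ≡ z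
    image {w} u~w = complete _ (subst (λ t → Adj t (φ A w)) Au≡u (proj₁ (proj₂ (aut A A∈GL) u w) u~w))
    adjacent : ∀ {w} → w ≡ x ⊎ w ≡ y ⊎ w ≡ z → Adj u w
    adjacent (inj₁ refl)        = u~x
    adjacent (inj₂ (inj₁ refl)) = u~y
    adjacent (inj₂ (inj₂ refl)) = u~z

  fixes⇒trace²≡1 : ∀ {A} → InSL A → ¬ Scalar A → Fixes (φ A) → tr A *F tr A ≡ 1F
  fixes⇒trace²≡1 {A} A∈SL ¬scalar fixes = scalar-cube⇒trace²≡1 {A} A∈SL ¬scalar
    (proj₁ (ker (A · (A · A)) (SL⇒GL {A · (A · A)} (SL-· {A} {A · A} A∈SL (SL-· {A} {A} A∈SL A∈SL)))) (fixes⇒cube≈id {A} A∈SL fixes))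

  module _ {A : Mat} (A∈SL : InSL A) (t²≡1 : tr A *F tr A ≡ 1F) where

    private
      t = tr A
      -- As t = ±1, the matrix t A has trace t² = 1 and induces the same permutation as A.
      A′ = scalar t · A
      P = krylov A′

      t≢0 : t ≢ 0F
      t≢0 t≡0 = 0≢1 (trans (sym (trans (cong (_*F t) t≡0) (zeroˡ t))) t²≡1)

      t∈SL : InSL (scalar t)
      t∈SL = trans (det-scalar t) t²≡1

      A′∈SL : InSL A′
      A′∈SL = SL-· {scalar t} {A} t∈SL A∈SL

      trA′≡1 : tr A′ ≡ 1F
      trA′≡1 = trans (tr-scalar-· t A) t²≡1

      φA′≈φA : φ A′ ≈ₚ φ A
      φA′≈φA x = trans (hom (scalar t) A (SL⇒GL {scalar t} t∈SL) (SL⇒GL {A} A∈SL) x) (φ-scalar-matrix t≢0 (φ A x))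

      P∈GL : InGL P
      P∈GL eq = m₂₁≢0 {A′} A′∈SL (trans (cong (λ s → s *F s) trA′≡1) (*-identityˡ 1F)) (trans (sym (det-krylov A′)) eq)

      companion∈SL : InSL companion
      companion∈SL = solve 0 (con (+ 0) :* con (+ 1) :+ :- ((:- con (+ 1)) :* con (+ 1)) := con (+ 1)) refl

      intertwines : (φ A ∘ φ P) ≈ₚ (φ P ∘ φ companion)
      intertwines x = begin
        φ A (φ P x)         ≡⟨ sym (φA′≈φA (φ P x)) ⟩
        φ A′ (φ P x)        ≡⟨ sym (hom A′ P (SL⇒GL {A′} A′∈SL) P∈GL x) ⟩
        φ (A′ · P) x        ≡⟨ cong (λ M → φ M x) (krylov-conjugates {A′} A′∈SL trA′≡1) ⟩
        φ (P · companion) x ≡⟨ hom P companion P∈GL (SL⇒GL {companion} companion∈SL) x ⟩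
        φ P (φ companion x) ∎
        where open ≡-Reasoning

    -- Conjugation by P carries fixed points across. The determinant of P may be a nonsquare, so
    -- this conjugation takes place in PGL, all of which acts on the vertices.
    fixes⇒companion-fixes : Fixes (φ A) → Fixes (φ companion)
    fixes⇒companion-fixes (v , Av≡v) = w , proj₁ (aut P P∈GL) (begin
      φ P (φ companion w) ≡⟨ sym (intertwines w) ⟩
      φ A (φ P w)         ≡⟨ cong (φ A) (φ-inverseʳ {P} P∈GL v) ⟩
      φ A v               ≡⟨ Av≡v ⟩
      v                   ≡⟨ sym (φ-inverseʳ {P} P∈GL v) ⟩
      φ P w               ∎)
      where
      open ≡-Reasoning
      w = φ (adj P) v

    companion-fixes⇒fixes : Fixes (φ companion) → Fixes (φ A)
    companion-fixes⇒fixes (w , Cw≡w) = φ P w , trans (intertwines w) (cong (φ P) Cw≡w)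

  -- By arc-transitivity some g in G fixes a vertex and moves one of its neighbours to another. It
  -- is not scalar, so its trace is ±1 and its fixed point passes to the companion matrix.
  companion-fixes : Fixes (φ companion)
  companion-fixes with cubic vertex
  ... | x , y , _ , u~x , u~y , _ , x≢y , _ with proj₁ arcRegular vertex x vertex y u~x u~y
  ... | g , g∈G , gu≡u , gx≡y with G⇒SL g g∈G
  ... | A , A∈SL , φA≈g = fixes⇒companion-fixes {A} A∈SL (fixes⇒trace²≡1 {A} A∈SL ¬scalar fixes) fixes
    where
    fixes : Fixes (φ A)
    fixes = vertex , trans (φA≈g vertex) gu≡u
    ¬scalar : ¬ Scalar A
    ¬scalar scalarA = x≢y (trans (sym (φ-scalar {A} (SL⇒GL {A} A∈SL) scalarA x)) (trans (φA≈g x) gx≡y))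

  Meet : Perm n → Perm n → Set
  Meet f g = ∃[ v ] (f v ≡ g v)

  module _ {A B : Mat} (A∈SL : InSL A) (B∈SL : InSL B) where

    private
      C = adj A · B
      C∈SL = SL-· {adj A} {B} (SL-adj {A} A∈SL) B∈SL
      A∈GL = SL⇒GL {A} A∈SL
      B∈GL = SL⇒GL {B} B∈SL

      φC : φ C ≈ₚ (φ (adj A) ∘ φ B)
      φC = hom (adj A) B (GL-adj {A} A∈GL) B∈GL

      φAφC : (φ A ∘ φ C) ≈ₚ φ B
      φAφC x = trans (cong (φ A) (φC x)) (φ-inverseʳ {A} A∈GL (φ B x))

    -- A and B agree at v exactly when C = A⁻¹ B fixes v, and the trace of C is ⟨ A , B ⟩ by
    -- definition. Distinctness keeps C from being scalar.
    meet⇒⌢ : ¬ (φ A ≈ₚ φ B) → Meet (φ A) (φ B) → A ⌢ B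
    meet⇒⌢ A≉B (v , Av≡Bv) = fixes⇒trace²≡1 {C} C∈SL
      (λ scalarC → A≉B λ x → trans (cong (φ A) (sym (φ-scalar {C} (SL⇒GL {C} C∈SL) scalarC x))) (φAφC x))
      (v , trans (φC v) (trans (cong (φ (adj A)) (sym Av≡Bv)) (φ-inverseˡ {A} A∈GL v)))

    ⌢⇒meet : A ⌢ B → Meet (φ A) (φ B)
    ⌢⇒meet A⌢B = let (v , Cv≡v) = companion-fixes⇒fixes {C} C∈SL A⌢B companion-fixes in
      v , trans (cong (φ A) (sym Cv≡v)) (φAφC v)

    -- Equal permutations would make C scalar, but its lower left entry is nonzero by `m₂₁≢0`.
    ⌢⇒distinct : A ⌢ B → ¬ (φ A ≈ₚ φ B)
    ⌢⇒distinct A⌢B A≈B = m₂₁≢0 {C} C∈SL A⌢B (proj₁ (proj₂ (proj₁ (ker C (SL⇒GL {C} C∈SL))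
      λ x → trans (φC x) (trans (cong (φ (adj A)) (sym (A≈B x))) (φ-inverseˡ {A} A∈GL x)))))

  clique⇒intersecting : ∀ {Ms} → All InSL Ms → AllPairs _⌢_ Ms → Intersecting G (map φ Ms)
  clique⇒intersecting {Ms} Ms⊆SL clique = All.map⁺ (All.map (λ {A} → SL⇒G A) Ms⊆SL) , AllPairs.map⁺ (distinct Ms⊆SL clique) , meets
    where
    distinct : ∀ {Ms} → All InSL Ms → AllPairs _⌢_ Ms → AllPairs (λ A B → ¬ (φ A ≈ₚ φ B)) Ms
    distinct [] [] = []
    distinct (_∷_ {A} A∈SL Ms⊆SL) (A⌢ ∷ clique) =
      All.zipWith (λ {B} (B∈SL , A⌢B) → ⌢⇒distinct {A} {B} A∈SL B∈SL A⌢B) (Ms⊆SL , A⌢) ∷ distinct Ms⊆SL clique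
    meets : ∀ f g → f ∈ map φ Ms → g ∈ map φ Ms → Meet f g
    meets f g f∈ g∈ with ∈-map⁻ φ f∈ | ∈-map⁻ φ g∈
    ... | A , A∈ , refl | B , B∈ , refl with allPairs-lookup clique A∈ B∈
    -- That a member meets itself requires a vertex to exist.
    ... | inj₁ refl = vertex , refl
    ... | inj₂ (inj₁ A⌢B) = ⌢⇒meet {A} {B} (All.lookup Ms⊆SL A∈) (All.lookup Ms⊆SL B∈) A⌢B
    ... | inj₂ (inj₂ B⌢A) = let (v , eq) = ⌢⇒meet {B} {A} (All.lookup Ms⊆SL B∈) (All.lookup Ms⊆SL A∈) B⌢A in v , sym eq

  -- Members of L agree with values of φ only pointwise, so the correspondence is recorded member by
  -- member rather than as an equality with `map φ Ms`.
  data Lifts : List (Perm n) → List Mat → Set where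
    []  : Lifts [] []
    _∷_ : ∀ {f L A Ms} → φ A ≈ₚ f → Lifts L Ms → Lifts (f ∷ L) (A ∷ Ms)

  lift : ∀ {L} → All G L → ∃[ Ms ] (All InSL Ms × Lifts L Ms)
  lift [] = [] , [] , []
  lift {f ∷ _} (f∈G ∷ L⊆G) with G⇒SL f f∈G | lift L⊆G
  ... | A , A∈SL , A≈f | Ms , Ms⊆SL , lifts = A ∷ Ms , A∈SL ∷ Ms⊆SL , A≈f ∷ lifts

  intersecting⇒clique : ∀ {L} → Intersecting G L → ∃[ Ms ] (All InSL Ms × AllPairs _⌢_ Ms × length Ms ≡ length L)
  intersecting⇒clique (L⊆G , distinct , meets) with lift L⊆G
  ... | Ms , Ms⊆SL , lifts = Ms , Ms⊆SL , pairs Ms⊆SL lifts distinct meets , lengths lifts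
    where
    lengths : ∀ {L Ms} → Lifts L Ms → length Ms ≡ length L
    lengths []          = refl
    lengths (_ ∷ lifts) = cong suc (lengths lifts)
    row : ∀ {A f L Ms} → InSL A → φ A ≈ₚ f → All InSL Ms → Lifts L Ms →
          All (λ g → ¬ (f ≈ₚ g)) L → (∀ {g} → g ∈ L → Meet f g) → All (A ⌢_) Ms
    row _ _ _ [] _ _ = []
    row {A} A∈SL A≈f (_∷_ {B} B∈SL Ms⊆SL) (B≈g ∷ lifts) (f≉g ∷ f≉) meets =
      meet⇒⌢ {A} {B} A∈SL B∈SL (λ A≈B → f≉g λ x → trans (sym (A≈f x)) (trans (A≈B x) (B≈g x)))
        (let (v , eq) = meets (here refl) in v , trans (A≈f v) (trans eq (sym (B≈g v))))
      ∷ row {A} A∈SL A≈f Ms⊆SL lifts f≉ (meets ∘ there)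
    pairs : ∀ {L Ms} → All InSL Ms → Lifts L Ms → Distinct L → (∀ f g → f ∈ L → g ∈ L → Meet f g) → AllPairs _⌢_ Ms
    pairs [] [] _ _ = []
    pairs (A∈SL ∷ Ms⊆SL) (A≈f ∷ lifts) (f≉ ∷ distinct) meets =
      row A∈SL A≈f Ms⊆SL lifts f≉ (λ g∈ → meets _ _ (here refl) (there g∈))
      ∷ pairs Ms⊆SL lifts distinct (λ f g f∈ g∈ → meets f g (there f∈) (there g∈))

  -- Normalising by the first of five members leaves four normal matrices of the kind excluded by
  -- `no-five`.
  clique≤4 : ∀ {Ms} → All InSL Ms → AllPairs _⌢_ Ms → length Ms ≤ 4
  clique≤4 [] _ = z≤n
  clique≤4 (_ ∷ []) _ = s≤s z≤n
  clique≤4 (_ ∷ _ ∷ []) _ = s≤s (s≤s z≤n)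
  clique≤4 (_ ∷ _ ∷ _ ∷ []) _ = s≤s (s≤s (s≤s z≤n))
  clique≤4 (_ ∷ _ ∷ _ ∷ _ ∷ []) _ = s≤s (s≤s (s≤s (s≤s z≤n)))
  clique≤4 {M ∷ A ∷ B ∷ C ∷ D ∷ _} (m ∷ a ∷ b ∷ c ∷ d ∷ _)
    ((ma ∷ mb ∷ mc ∷ md ∷ _) ∷ (ab ∷ ac ∷ ad ∷ _) ∷ (bc ∷ bd ∷ _) ∷ (cd ∷ _) ∷ _) = ⊥-elim (no-five
      (normalise-normal {M} {A} m a ma) (normalise-normal {M} {B} m b mb)
      (normalise-normal {M} {C} m c mc) (normalise-normal {M} {D} m d md)
      (normalise-⌢ {M} {A} {B} m ma mb ab) (normalise-⌢ {M} {A} {C} m ma mc ac) (normalise-⌢ {M} {A} {D} m ma md ad)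
      (normalise-⌢ {M} {B} {C} m mb mc bc) (normalise-⌢ {M} {B} {D} m mb md bd) (normalise-⌢ {M} {C} {D} m mc md cd))

  -- Normalising by the first of four members leaves three matrices whose squared volume is 80 = 16
  -- · 5, which makes 5 a square.
  no-golden⇒clique≤3 : ¬ (∃[ s ] Golden s) → ∀ {Ms} → All InSL Ms → AllPairs _⌢_ Ms → length Ms ≤ 3
  no-golden⇒clique≤3 _ [] _ = z≤n
  no-golden⇒clique≤3 _ (_ ∷ []) _ = s≤s z≤n
  no-golden⇒clique≤3 _ (_ ∷ _ ∷ []) _ = s≤s (s≤s z≤n)
  no-golden⇒clique≤3 _ (_ ∷ _ ∷ _ ∷ []) _ = s≤s (s≤s (s≤s z≤n))
  no-golden⇒clique≤3 no-golden {M ∷ A ∷ B ∷ C ∷ _} (m ∷ a ∷ b ∷ c ∷ _)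
    ((ma ∷ mb ∷ mc ∷ _) ∷ (ab ∷ ac ∷ _) ∷ (bc ∷ _) ∷ _) = ⊥-elim (no-golden (5-square⇒golden
      (proj₂ (proj₂ (proj₂ (positive {normalise M A} {normalise M B} {normalise M C}
        (normalise-normal {M} {A} m a ma) (normalise-normal {M} {B} m b mb) (normalise-normal {M} {C} m c mc)
        (normalise-⌢ {M} {A} {B} m ma mb ab) (normalise-⌢ {M} {A} {C} m ma mc ac) (normalise-⌢ {M} {B} {C} m mb mc bc)))))))

  unit-pairing⇒⌢ : ∀ {A B} → ⟨ A , B ⟩ ≡ 1F → A ⌢ B
  unit-pairing⇒⌢ eq = trans (cong (λ t → t *F t) eq) (*-identityˡ 1F)

  1ₘ⌢quaternion : ∀ x y z → 1ₘ ⌢ quaternion x y z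
  1ₘ⌢quaternion x y z = unit-pairing⇒⌢ {1ₘ} {quaternion x y z} (trans (pairing-1ₘ (quaternion x y z)) (tr-quaternion x y z))

  Q₊ Q₋ : Mat
  Q₊ = quaternion 1F 1F 1F
  Q₋ = quaternion 1F 1F (-F 1F)

  Q₊∈SL : InSL Q₊
  Q₊∈SL = det-quaternion 1F 1F 1F (solve 0 (con (+ 1) :* con (+ 1) :+ con (+ 1) :* con (+ 1) :+ con (+ 1) :* con (+ 1) := con (+ 3)) refl)

  Q₋∈SL : InSL Q₋
  Q₋∈SL = det-quaternion 1F 1F (-F 1F)
    (solve 0 (con (+ 1) :* con (+ 1) :+ con (+ 1) :* con (+ 1) :+ (:- con (+ 1)) :* (:- con (+ 1)) := con (+ 3)) refl)

  Q₊⌢Q₋ : Q₊ ⌢ Q₋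
  Q₊⌢Q₋ = unit-pairing⇒⌢ {Q₊} {Q₋} (pairing-quaternion 1F 1F 1F 1F 1F (-F 1F)
    (solve 0 (con (+ 1) :* con (+ 1) :+ con (+ 1) :* con (+ 1) :+ con (+ 1) :* (:- con (+ 1)) := con (+ 1)) refl))

  intersecting₃ : Intersecting G (map φ (1ₘ ∷ Q₊ ∷ Q₋ ∷ []))
  intersecting₃ = clique⇒intersecting (det-1ₘ ∷ Q₊∈SL ∷ Q₋∈SL ∷ [])
    ((1ₘ⌢quaternion 1F 1F 1F ∷ 1ₘ⌢quaternion 1F 1F (-F 1F) ∷ []) ∷ (Q₊⌢Q₋ ∷ []) ∷ [] ∷ [])

  module _ {s : Fin q} (golden : Golden s) where

    -- A vector (x, y, 0) with x + y = 1 has inner product 1 with both (1, 1, ±1). For x = -s the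
    -- norm condition x² + y² = 3 becomes s² + s = 1.
    Qₛ : Mat
    Qₛ = quaternion (-F s) (1F +F s) 0F

    Qₛ∈SL : InSL Qₛ
    Qₛ∈SL = det-quaternion (-F s) (1F +F s) 0F (by₁ golden (solve 1 (λ s →
      (:- s) :* (:- s) :+ (con (+ 1) :+ s) :* (con (+ 1) :+ s) :+ con (+ 0) :* con (+ 0) :- con (+ 3) :=
      con (+ 2) :* (s :* s :- (con (+ 1) :- s))) refl s))

    Q±⌢Qₛ : ∀ z → quaternion 1F 1F z ⌢ Qₛ
    Q±⌢Qₛ z = unit-pairing⇒⌢ {quaternion 1F 1F z} {Qₛ} (pairing-quaternion 1F 1F z (-F s) (1F +F s) 0F
      (solve 2 (λ s z → con (+ 1) :* (:- s) :+ con (+ 1) :* (con (+ 1) :+ s) :+ z :* con (+ 0) := con (+ 1)) refl s z))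

    intersecting₄ : Intersecting G (map φ (1ₘ ∷ Q₊ ∷ Q₋ ∷ Qₛ ∷ []))
    intersecting₄ = clique⇒intersecting (det-1ₘ ∷ Q₊∈SL ∷ Q₋∈SL ∷ Qₛ∈SL ∷ [])
      ((1ₘ⌢quaternion 1F 1F 1F ∷ 1ₘ⌢quaternion 1F 1F (-F 1F) ∷ 1ₘ⌢quaternion (-F s) (1F +F s) 0F ∷ [])
       ∷ (Q₊⌢Q₋ ∷ Q±⌢Qₛ 1F ∷ []) ∷ (Q±⌢Qₛ (-F 1F) ∷ []) ∷ [] ∷ [])

  order : HasOrder G (n * 3)
  order = Arcs.arcRegular⇒order X cubic G⊆Aut arcRegular vertex
    where
    G⊆Aut : ∀ g → G g → IsAut X g
    G⊆Aut g g∈G = let (A , A∈SL , A≈g) = G⇒SL g g∈G in IsAut-resp-≈ₚ {X = X} A≈g (aut A (SL⇒GL {A} A∈SL))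

  -- As G has order 3 n, a maximum of 4 amounts to density 4/3.
  golden⇒density : ∃[ s ] Golden s → DensityIs G 4 3
  golden⇒density (_ , golden) = 4 , n * 3 , order , ((_ , intersecting₄ golden , refl) , bound) , ℕₚ.*-assoc 4 n 3
    where
    bound : ∀ L → Intersecting G L → length L ≤ 4
    bound L intersecting = let (_ , Ms⊆SL , clique , same) = intersecting⇒clique intersecting in
      subst (_≤ 4) same (clique≤4 Ms⊆SL clique)

  no-golden⇒density : ¬ (∃[ s ] Golden s) → DensityIs G 1 1
  no-golden⇒density no-golden = 3 , n * 3 , order , ((_ , intersecting₃ , refl) , bound) ,
    trans (ℕₚ.*-identityʳ (3 * n)) (trans (ℕₚ.*-comm 3 n) (sym (ℕₚ.*-identityˡ (n * 3))))
    where
    bound : ∀ L → Intersecting G L → length L ≤ 3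
    bound L intersecting = let (_ , Ms⊆SL , clique , same) = intersecting⇒clique intersecting in
      subst (_≤ 3) same (no-golden⇒clique≤3 no-golden Ms⊆SL clique)

  -- This serves powers of 5 and q ≡ ±1 alike: without a golden element q would be ±2 modulo 5.
  q≢±2⇒density : q % 5 ≢ 2 → q % 5 ≢ 3 → DensityIs G 4 3
  q≢±2⇒density q≢2 q≢3 with golden?
  ... | yes golden   = golden⇒density golden
  ... | no no-golden = ⊥-elim ([ q≢2 , q≢3 ]′ (no-golden⇒q≡±2 no-golden))

theorem6p5 : (q : ℕ) → IsPrimePower q → q % 2 ≡ 1 → q % 3 ≡ 2 →
    (F : FieldOn q) →
    let open Matrices F in
    (n : ℕ) (X : Graph n) → Connected X → Cubic X → TypeOne2one X →
    (φ : Mat → Perm n) →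
    (∀ A B → InGL A → InGL B → φ (A · B) ≈ₚ (φ A ∘ φ B)) →
    (∀ A → InGL A → (φ A ≈ₚ id → Scalar A) × (Scalar A → φ A ≈ₚ id)) →
    (∀ σ → (IsAut X σ → ∃[ A ] (InGL A × φ A ≈ₚ σ)) ×
    (∀ A → InGL A → φ A ≈ₚ σ → IsAut X σ)) →
    (G : PermSet n) →
    (∀ σ → (G σ → ∃[ A ] (InSL A × φ A ≈ₚ σ)) ×
    (∀ A → InSL A → φ A ≈ₚ σ → G σ)) →
    ArcRegular X G →
    ((∃[ k ] (q ≡ 5 ^ (2 * k + 1))) → DensityIs G 4 3) ×
    ((q % 5 ≡ 2 ⊎ q % 5 ≡ 3) → DensityIs G 1 1) ×
    ((q % 5 ≡ 1 ⊎ q % 5 ≡ 4) → DensityIs G 4 3)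
theorem6p5 q _ odd q≡2 F n X _ cubic _ φ hom ker aut G G≡PSL arcRegular =
  (λ (k , q≡5ᵏ) → residue-density (trans (cong (_% 5) q≡5ᵏ) (5ᵏ%5≡0 k)) (λ ()) (λ ())) ,
  (λ q≡±2 → no-golden⇒density (q≡±2⇒no-golden q≡±2)) ,
  [ (λ q≡1 → residue-density q≡1 (λ ()) (λ ())) , (λ q≡4 → residue-density q≡4 (λ ()) (λ ())) ]′
  where
  open Action F odd q≡2 X cubic φ hom ker (λ A A∈GL → proj₂ (aut (φ A)) A A∈GL (λ _ → refl))
    G (λ σ → proj₁ (G≡PSL σ)) (λ A A∈SL → proj₂ (G≡PSL (φ A)) A A∈SL (λ _ → refl)) arcRegular
  open FieldCounting F using (q≡±2⇒no-golden)
  residue-density : ∀ {r} → q % 5 ≡ r → r ≢ 2 → r ≢ 3 → DensityIs G 4 3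
  residue-density refl = q≢±2⇒density
  5ᵏ%5≡0 : ∀ k → 5 ^ (2 * k + 1) % 5 ≡ 0
  5ᵏ%5≡0 k = n∣m⇒m%n≡0 _ 5 (subst (λ e → 5 ∣ (5 ^ e)) (ℕₚ.+-comm 1 (2 * k)) (m∣m*n (5 ^ (2 * k))))
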